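{- There is a polynomial-time $(2\ln\frac{m}{2})$-approximation algorithm for the minimum representation subset problem on instances $(W,s)$ with $s\notin\{\mathbf{0},\mathbf{1}\}$: given a finite set $W\subseteq\{0,1\}^m$ of binary strings of length $m$ and a string $s\in\{0,1\}^m$ with $s\notin\{\mathbf{0},\mathbf{1}\}$ that is representable by $W$, it outputs a subset $C\subseteq W$ such that $s$ is representable by $C$ and $|C|$ is at most $2\ln\frac{m}{2}$ times the minimum cardinality of a subset of $W$ by which $s$ is representable.
   Context: $\mathbf{0}$ and $\mathbf{1}$ denote the all-zero and the all-one string of length $m$. For strings $x,y\in\{0,1\}^m$, $x\wedge y$ and $x\vee y$ denote bitwise AND and bitwise OR. A string $s$ is representable by a set $C$ of strings if there is a formula with operators in $\{\wedge,\vee\}$ (no negation) and operands in $C$ which evaluates to $s$. The minimum representation subset problem asks, given $(W,s)$ with $s$ representable by $W$, for a subset of $W$ of minimum cardinality by which $s$ is representable.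
   Formalization: The ratio bound is claimed only for m ≥ 4: for m = 2 and m = 3 the factor 2 ln(m/2) is below 1 (0 and about 0.81), so no output can meet it, e.g. W = {s} with s = 01; polynomial time and representability of s by the output C are claimed for all m. -}

module Defs where

open import Data.Bool using (Bool; true; false; _∧_; _∨_)
open import Data.Fin using (Fin)
open import Data.Integer using (+_)
open import Data.List using (List; []; _∷_; length)
open import Data.List.Membership.Propositional using (_∈_)
open import Data.List.Relation.Binary.Subset.Propositional using (_⊆_)
open import Data.List.Relation.Unary.Unique.Propositional using (Unique)
open import Data.Nat using (ℕ; zero; suc; _+_; _*_; _^_; _≤_)
open import Data.Product using (∃-syntax; _×_)
open import Data.Rational as ℚ using (ℚ; 0ℚ; 1ℚ)
open import Data.Vec using (Vec; []; _∷_; lookup; replicate; toList; zipWith)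
open import Relation.Binary.PropositionalEquality using (_≡_; _≢_)

------------------------------------------------------------------------
-- Representability

BitString : ℕ → Set
BitString m = Vec Bool m

𝟎 𝟏 : ∀ m → BitString m
𝟎 m = replicate m false
𝟏 m = replicate m true

data Formula {m : ℕ} (C : List (BitString m)) : Set where
  operand : (x : BitString m) → x ∈ C → Formula C
  _⟨∧⟩_   : Formula C → Formula C → Formula C
  _⟨∨⟩_   : Formula C → Formula C → Formula C

eval : ∀ {m} {C : List (BitString m)} → Formula C → BitString m
eval (operand x _) = x
eval (φ ⟨∧⟩ ψ)     = zipWith _∧_ (eval φ) (eval ψ)
eval (φ ⟨∨⟩ ψ)     = zipWith _∨_ (eval φ) (eval ψ)

Representable : ∀ {m} → List (BitString m) → BitString m → Set
Representable C s = ∃[ φ ] eval {C = C} φ ≡ s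

------------------------------------------------------------------------
-- The minimum representation subset problem

-- A finite set of strings is a list without repetitions, so that its
-- cardinality is the length of the list.

record Instance : Set where
  field
    m             : ℕ
    W             : List (BitString m)
    W-unique      : Unique W
    s             : BitString m
    s≢𝟎           : s ≢ 𝟎 m
    s≢𝟏           : s ≢ 𝟏 m
    representable : Representable W s

record RepresentationSubset (I : Instance) : Set where
  open Instance I using (m; W; s)
  field
    C             : List (BitString m)
    C-unique      : Unique C
    C⊆W           : C ⊆ W
    representable : Representable C s

∣_∣ : ∀ {I} → RepresentationSubset I → ℕ
∣ R ∣ = length (RepresentationSubset.C R)

IsMinimumCardinality : Instance → ℕ → Set
IsMinimumCardinality I k =
  (∃[ R ] ∣_∣ {I} R ≡ k) × ((R : RepresentationSubset I) → k ≤ ∣ R ∣)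

------------------------------------------------------------------------
-- Logarithmic bounds

expTerm : ℚ → ℕ → ℚ
expTerm x zero    = 1ℚ
expTerm x (suc i) = expTerm x i ℚ.* x ℚ.* (+ 1 ℚ./ suc i)

-- expSum x n = Σ_{i<n} xⁱ / i!
expSum : ℚ → ℕ → ℚ
expSum x zero    = 0ℚ
expSum x (suc n) = expSum x n ℚ.+ expTerm x n

-- For x ≥ 0 the partial sums increase to eˣ, so all of them are at most q
-- exactly when eˣ ≤ q, that is, when x ≤ ln q.
infix 4 _≤ln_
_≤ln_ : ℚ → ℚ → Set
x ≤ln q = 0ℚ ℚ.≤ x × (∀ n → expSum x n ℚ.≤ q)

-- The real inequality c ≤ a · ln q, for q ≥ 1: some rational x with
-- 0 ≤ x ≤ ln q satisfies c ≤ a · x.  Nothing is lost by asking for a rational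
-- x: for a > 0 one can take c / a, and for a = 0 both sides say c = 0.
infix 4 _≤_·ln_
_≤_·ln_ : ℕ → ℕ → ℚ → Set
c ≤ a ·ln q = ∃[ x ] (x ≤ln q × (+ c ℚ./ 1) ℚ.≤ (+ a ℚ./ 1) ℚ.* x)

------------------------------------------------------------------------
-- Polynomial time

-- The machine model is a first-order LISP: programs are finite systems of
-- mutually recursive first-order functions on binary trees, evaluated by
-- value, in the style of the languages of N. D. Jones, "Computability and
-- Complexity from a Programming Perspective".  Each evaluation step builds or
-- inspects a single node, or passes a number of pointers fixed by the program,
-- so unit-cost time here and Turing machine time are polynomially related (for
-- outputs of polynomial size: shared subtrees are not copied).

infixr 5 _∙_
data Tree : Set where
  nil : Tree
  _∙_ : Tree → Tree → Tree

size : Tree → ℕ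
size nil     = 1
size (l ∙ r) = 1 + size l + size r

-- Expressions with n variables in scope, over the function symbols Fin F with
-- the given arities.  In case e e₀ e₁, the branch e₁ has the left and the right
-- subtree as its variables 0 and 1.
data Exp {F : ℕ} (arity : Fin F → ℕ) (n : ℕ) : Set where
  var  : Fin n → Exp arity n
  nil  : Exp arity n
  cons : Exp arity n → Exp arity n → Exp arity n
  case : Exp arity n → Exp arity n → Exp arity (2 + n) → Exp arity n
  call : (f : Fin F) → Vec (Exp arity n) (arity f) → Exp arity n

record Program : Set where
  field
    F     : ℕ
    arity : Fin F → ℕ
    body  : (f : Fin F) → Exp arity (arity f)
    main  : Exp arity 1

module Semantics (P : Program) where
  open Program P

  -- ρ ⊢ e ⇓ v [ t ]: in the environment ρ, e evaluates to v in t steps.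
  infix 3 _⊢_⇓_[_] _⊢*_⇓_[_]
  mutual
    data _⊢_⇓_[_] {n : ℕ} (ρ : Vec Tree n) : Exp arity n → Tree → ℕ → Set where
      var : ∀ i → ρ ⊢ var i ⇓ lookup ρ i [ 1 ]
      nil : ρ ⊢ nil ⇓ nil [ 1 ]
      cons : ∀ {e₁ e₂ v₁ v₂ t₁ t₂} →
             ρ ⊢ e₁ ⇓ v₁ [ t₁ ] →
             ρ ⊢ e₂ ⇓ v₂ [ t₂ ] →
             ρ ⊢ cons e₁ e₂ ⇓ v₁ ∙ v₂ [ 1 + t₁ + t₂ ]
      case-nil : ∀ {e e₀ e₁ v t t₀} →
                 ρ ⊢ e ⇓ nil [ t ] →
                 ρ ⊢ e₀ ⇓ v [ t₀ ] →
                 ρ ⊢ case e e₀ e₁ ⇓ v [ 1 + t + t₀ ]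
      case-cons : ∀ {e e₀ e₁ l r v t t₁} →
                  ρ ⊢ e ⇓ l ∙ r [ t ] →
                  l ∷ r ∷ ρ ⊢ e₁ ⇓ v [ t₁ ] →
                  ρ ⊢ case e e₀ e₁ ⇓ v [ 1 + t + t₁ ]
      call : ∀ {f es vs v t t′} →
             ρ ⊢* es ⇓ vs [ t ] →
             vs ⊢ body f ⇓ v [ t′ ] →
             ρ ⊢ call f es ⇓ v [ 1 + t + t′ ]

    data _⊢*_⇓_[_] {n : ℕ} (ρ : Vec Tree n) :
                   ∀ {k} → Vec (Exp arity n) k → Vec Tree k → ℕ → Set where
      []  : ρ ⊢* [] ⇓ [] [ 0 ]
      _∷_ : ∀ {k e v t t′} {es : Vec (Exp arity n) k} {vs} →
            ρ ⊢ e ⇓ v [ t ] →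
            ρ ⊢* es ⇓ vs [ t′ ] →
            ρ ⊢* e ∷ es ⇓ v ∷ vs [ t + t′ ]

_⟦_⟧⇓_[_] : Program → Tree → Tree → ℕ → Set
P ⟦ input ⟧⇓ output [ t ] = input ∷ [] ⊢ Program.main P ⇓ output [ t ]
  where open Semantics P

-- Sizes are positive, so every polynomial in the size is bounded by some
-- c * size ^ d.
PolynomialTime : {A : Set} {B : A → Set} →
                 (A → Tree) → (∀ {a} → B a → Tree) → ((a : A) → B a) → Set
PolynomialTime {A} encodeIn encodeOut f =
  ∃[ P ] ∃[ c ] ∃[ d ] ((a : A) →
    ∃[ t ] (P ⟦ encodeIn a ⟧⇓ encodeOut (f a) [ t ] ×
            t ≤ c * size (encodeIn a) ^ d))

encodeBit : Bool → Tree
encodeBit false = nil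
encodeBit true  = nil ∙ nil

encodeList : {A : Set} → (A → Tree) → List A → Tree
encodeList encode []       = nil
encodeList encode (x ∷ xs) = encode x ∙ encodeList encode xs

encodeString : ∀ {m} → BitString m → Tree
encodeString x = encodeList encodeBit (toList x)

encodeInstance : Instance → Tree
encodeInstance I = encodeList encodeString W ∙ encodeString s
  where open Instance I using (W; s)

encodeSolution : ∀ {I} → RepresentationSubset I → Tree
encodeSolution R = encodeList encodeString (RepresentationSubset.C R)

-- A set C represents s exactly when every pair (i , j) with sᵢ = 1 and sⱼ = 0
-- is separated by some x ∈ C with xᵢ = 1 and xⱼ = 0, so the problem is a set
-- cover problem with N ≤ m² / 4 elements.  Suppose that the optimum k is at
-- least 3, and that t is the last stage of the greedy algorithm which leaves at
-- least k pairs.  Every stage leaves at most the fraction 1 - 1 / k of the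
-- pairs, so that k ≤ N (1 - 1 / k)ᵗ, and the result C has at most t + k
-- elements; hence exp (|C| / k) ≤ (1 - 1 / k)⁻ᵗ e ≤ N e / k ≤ N ≤ m² / 4.
-- For k = 2 the greedy algorithm can fail (m = 4 and three strings instead of
-- two).  It is therefore run after each possible first choice, and the shortest
-- result is returned, which is optimal for k ≤ 2.

module Submission where

open import Defs
open import Data.Bool using (Bool; true; false; T; not; _∧_; _∨_; if_then_else_)
open import Data.Bool.Properties using (∧-zeroʳ; ∨-zeroʳ)
open import Data.Fin using (Fin; zero; suc; toℕ)
open import Data.Fin.Properties using (all?)
open import Data.Integer using (+_)
open import Data.List using (List; []; _∷_; length)
open import Data.List.Membership.Propositional using (_∈_)
open import Data.List.Relation.Binary.Subset.Propositional using (_⊆_)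
import Data.List.Relation.Unary.All as All
open import Data.List.Relation.Unary.AllPairs using ([]; _∷_)
open import Data.List.Relation.Unary.Any using (here; there)
open import Data.List.Relation.Unary.Unique.Propositional using (Unique)
open import Data.Nat using (ℕ; zero; suc)
open import Data.Product using (Σ-syntax; ∃-syntax; _×_; _,_; proj₁; proj₂)
open import Data.Sum using (_⊎_; inj₁; inj₂)
open import Data.Unit using (tt)
open import Data.Vec using (Vec; []; _∷_; lookup; toList; zipWith)
open import Data.Vec.Properties using (length-toList)
open import Relation.Binary.PropositionalEquality
  using (_≡_; _≢_; refl; sym; trans; cong; cong₂; subst)
open import Relation.Nullary using (yes; no; contradiction)
open import Relation.Nullary.Decidable using (toWitness)

-- Upper bounds for the exponential series

-- Everything is estimated on partial sums at rational arguments. The one analytic tool is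
-- `exp (x + 1 / q) ≤ exp x · q / (q - 1)`, iterated. Halving the exponent of the overview turns the
-- claim into `exp (c / 2k) ≤ m / 2`, where `c` is the size of the result and
-- `c / 2k ≤ t / 2k + 1 / 2`. A step of `1 / 2k` costs the factor `2k / (2k - 1)`, whose square is
-- still at most `k / (k - 1)`, so the stages of the greedy algorithm pay for it exactly. The
-- remaining `1 / 2` costs a constant whose square must not exceed 3, the least optimum in that
-- case. Lengths start at 4 because for 2 and 3 the factor `2 ln (m / 2)` is below 1, which no
-- algorithm can meet. The time bound rests on a hierarchy of functions whose bodies call themselves
-- at most once per evaluation, so that each level multiplies the time by a polynomial only.

module Logarithm where
  import Data.Integer as ℤ
  import Data.Integer.Properties as ℤₚ
  import Data.Nat as ℕ
  import Data.Nat.Properties as ℕₚ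
  open import Data.Rational
  open import Data.Rational.Properties
  open import Data.Rational.Solver using (module +-*-Solver)
  open import Data.Rational.Unnormalised as ℚᵘ using (mkℚᵘ; *≡*; *≤*)
  import Data.Rational.Unnormalised.Properties as ℚᵘₚ

  ι : ℕ → ℚ
  ι n = + n / 1

  fromℚᵘ-homo-+ : ∀ p q → fromℚᵘ (p ℚᵘ.+ q) ≡ fromℚᵘ p + fromℚᵘ q
  fromℚᵘ-homo-+ p q = toℚᵘ-injective (begin
    toℚᵘ (fromℚᵘ (p ℚᵘ.+ q))                   ≈⟨ toℚᵘ-fromℚᵘ (p ℚᵘ.+ q) ⟩
    p ℚᵘ.+ q                                   ≈⟨ ℚᵘₚ.+-cong (toℚᵘ-fromℚᵘ p) (toℚᵘ-fromℚᵘ q) ⟨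
    toℚᵘ (fromℚᵘ p) ℚᵘ.+ toℚᵘ (fromℚᵘ q)       ≈⟨ toℚᵘ-homo-+ (fromℚᵘ p) (fromℚᵘ q) ⟨
    toℚᵘ (fromℚᵘ p + fromℚᵘ q)                 ∎)
    where open ℚᵘₚ.≃-Reasoning

  fromℚᵘ-homo-* : ∀ p q → fromℚᵘ (p ℚᵘ.* q) ≡ fromℚᵘ p * fromℚᵘ q
  fromℚᵘ-homo-* p q = toℚᵘ-injective (begin
    toℚᵘ (fromℚᵘ (p ℚᵘ.* q))                   ≈⟨ toℚᵘ-fromℚᵘ (p ℚᵘ.* q) ⟩
    p ℚᵘ.* q                                   ≈⟨ ℚᵘₚ.*-cong (toℚᵘ-fromℚᵘ p) (toℚᵘ-fromℚᵘ q) ⟨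
    toℚᵘ (fromℚᵘ p) ℚᵘ.* toℚᵘ (fromℚᵘ q)       ≈⟨ toℚᵘ-homo-* (fromℚᵘ p) (fromℚᵘ q) ⟨
    toℚᵘ (fromℚᵘ p * fromℚᵘ q)                 ∎)
    where open ℚᵘₚ.≃-Reasoning

  ι-+ : ∀ a b → ι (a ℕ.+ b) ≡ ι a + ι b
  ι-+ a b = trans (fromℚᵘ-cong {mkℚᵘ (+ (a ℕ.+ b)) 0} {A ℚᵘ.+ B} (*≡* (cong (ℤ._* + 1) numerators)))
                  (fromℚᵘ-homo-+ A B)
    where
    A = mkℚᵘ (+ a) 0
    B = mkℚᵘ (+ b) 0
    numerators : + (a ℕ.+ b) ≡ + a ℤ.* + 1 ℤ.+ + b ℤ.* + 1
    numerators = trans (ℤₚ.pos-+ a b)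
                       (sym (cong₂ ℤ._+_ (ℤₚ.*-identityʳ (+ a)) (ℤₚ.*-identityʳ (+ b))))

  ι-* : ∀ a b → ι (a ℕ.* b) ≡ ι a * ι b
  ι-* a b = trans (cong (_/ 1) (ℤₚ.pos-* a b)) (fromℚᵘ-homo-* (mkℚᵘ (+ a) 0) (mkℚᵘ (+ b) 0))

  ι-mono : ∀ {a b} → a ℕ.≤ b → ι a ≤ ι b
  ι-mono {a} {b} a≤b = toℚᵘ-cancel-≤ (begin
    toℚᵘ (ι a)    ≃⟨ toℚᵘ-fromℚᵘ (mkℚᵘ (+ a) 0) ⟩
    mkℚᵘ (+ a) 0  ≤⟨ *≤* (ℤₚ.*-monoʳ-≤-nonNeg (+ 1) (ℤ.+≤+ a≤b)) ⟩
    mkℚᵘ (+ b) 0  ≃⟨ toℚᵘ-fromℚᵘ (mkℚᵘ (+ b) 0) ⟨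
    toℚᵘ (ι b)    ∎)
    where open ℚᵘₚ.≤-Reasoning

  ι-/ : ∀ a d → ι (suc d) * (+ a / suc d) ≡ ι a
  ι-/ a d = trans (sym (fromℚᵘ-homo-* D (mkℚᵘ (+ a) d)))
                  (fromℚᵘ-cong {D ℚᵘ.* mkℚᵘ (+ a) d} {mkℚᵘ (+ a) 0} (*≡* cross))
    where
    D = mkℚᵘ (+ suc d) 0
    cross : + suc d ℤ.* + a ℤ.* + 1 ≡ + a ℤ.* + suc (d ℕ.+ 0)
    cross = trans (ℤₚ.*-identityʳ _)
           (trans (ℤₚ.*-comm (+ suc d) (+ a)) (cong (λ n → + a ℤ.* + suc n) (sym (ℕₚ.+-identityʳ d))))

  open ≤-Reasoning

  0≤ι : ∀ n → 0ℚ ≤ ι n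
  0≤ι n = ι-mono {0} {n} ℕ.z≤n

  0≤1/ : ∀ n → 0ℚ ≤ + 1 / suc n
  0≤1/ n = nonNegative⁻¹ (+ 1 / suc n) {{normalize-nonNeg 1 (suc n)}}

  0≤-+ : ∀ {p q} → 0ℚ ≤ p → 0ℚ ≤ q → 0ℚ ≤ p + q
  0≤-+ 0≤p 0≤q = +-mono-≤ 0≤p 0≤q

  *-monoˡ : ∀ {r p q} → 0ℚ ≤ r → p ≤ q → r * p ≤ r * q
  *-monoˡ {r} 0≤r = *-monoˡ-≤-nonNeg r {{nonNegative 0≤r}}

  *-monoʳ : ∀ {r p q} → 0ℚ ≤ r → p ≤ q → p * r ≤ q * r
  *-monoʳ {r} 0≤r = *-monoʳ-≤-nonNeg r {{nonNegative 0≤r}}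

  0≤-* : ∀ {p q} → 0ℚ ≤ p → 0ℚ ≤ q → 0ℚ ≤ p * q
  0≤-* {p} 0≤p 0≤q = ≤-trans (≤-reflexive (sym (*-zeroʳ p))) (*-monoˡ 0≤p 0≤q)

  *-swap : ∀ p q r → p * (q * r) ≡ q * (p * r)
  *-swap = solve 3 (λ p q r → p :* (q :* r) := q :* (p :* r)) refl
    where open +-*-Solver

  expTerm-suc : ∀ x n → ι (suc n) * expTerm x (suc n) ≡ x * expTerm x n
  expTerm-suc x n = begin-equality
    ι (suc n) * (expTerm x n * x * (+ 1 / suc n))
      ≡⟨ solve 4 (λ a e x r → a :* (e :* x :* r) := (a :* r) :* (x :* e))
               refl (ι (suc n)) (expTerm x n) x (+ 1 / suc n) ⟩
    (ι (suc n) * (+ 1 / suc n)) * (x * expTerm x n)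
      ≡⟨ cong (_* (x * expTerm x n)) (ι-/ 1 n) ⟩
    1ℚ * (x * expTerm x n)
      ≡⟨ *-identityˡ _ ⟩
    x * expTerm x n ∎
    where open +-*-Solver

  0≤expTerm : ∀ {x} → 0ℚ ≤ x → ∀ n → 0ℚ ≤ expTerm x n
  0≤expTerm 0≤x zero    = 0≤ι 1
  0≤expTerm 0≤x (suc n) = 0≤-* (0≤-* (0≤expTerm 0≤x n) 0≤x) (0≤1/ n)

  ι-suc : ∀ n → ι (suc n) ≡ 1ℚ + ι n
  ι-suc n = ι-+ 1 n

  module Shift {x z : ℚ} (0≤x : 0ℚ ≤ x) (0≤z : 0ℚ ≤ z) where

    -- The coefficients of the product of the series of exp x and of 1 / (1 - z).
    g : ℕ → ℚ
    g zero    = 1ℚ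
    g (suc n) = z * g n + expTerm x (suc n)

    0≤g : ∀ n → 0ℚ ≤ g n
    0≤g zero    = 0≤ι 1
    0≤g (suc n) = 0≤-+ (0≤-* 0≤z (0≤g n)) (0≤expTerm 0≤x (suc n))

    -- The terms of `exp (x + z)` satisfy this recurrence with equality, so the inequality keeps `g`
    -- above them without any appeal to the binomial theorem.
    g-growth : ∀ n → (x + z) * g n ≤ ι (suc n) * g (suc n)
    g-growth zero = ≤-reflexive 
      (solve 2 (λ x z → (x :+ z) :* con 1ℚ := con 1ℚ :* (z :* con 1ℚ :+ con 1ℚ :* x :* con 1ℚ))
             refl x z)
      where open +-*-Solver
    g-growth (suc n) = begin
      (x + z) * g (suc n)
        ≡⟨ solve 4 (λ x z g e → (x :+ z) :* (z :* g :+ e) :=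
                                z :* (x :* g) :+ (x :* e :+ z :* (z :* g :+ e)))
                 refl x z (g n) (expTerm x (suc n)) ⟩
      z * (x * g n) + rest
        ≤⟨ +-monoˡ-≤ rest (*-monoˡ 0≤z (≤-trans x*g≤ (g-growth n))) ⟩
      z * (ι (suc n) * g (suc n)) + rest
        ≡⟨ solve 4 (λ z i g xe → z :* (i :* g) :+ (xe :+ z :* g) :=
                                 (con 1ℚ :+ i) :* (z :* g) :+ xe)
                 refl z (ι (suc n)) (g (suc n)) (x * expTerm x (suc n)) ⟩
      (1ℚ + ι (suc n)) * (z * g (suc n)) + x * expTerm x (suc n)
        ≡⟨ cong₂ (λ i e → i * (z * g (suc n)) + e) (ι-suc (suc n)) (expTerm-suc x (suc n)) ⟨
      ι (suc (suc n)) * (z * g (suc n)) + ι (suc (suc n)) * expTerm x (suc (suc n))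
        ≡⟨ *-distribˡ-+ (ι (suc (suc n))) _ _ ⟨
      ι (suc (suc n)) * g (suc (suc n)) ∎
      where
      open +-*-Solver
      rest = x * expTerm x (suc n) + z * g (suc n)
      x*g≤ : x * g n ≤ (x + z) * g n
      x*g≤ = *-monoʳ (0≤g n) (≤-trans (≤-reflexive (sym (+-identityʳ x))) (+-monoʳ-≤ x 0≤z))

    expTerm≤g : ∀ n → expTerm (x + z) n ≤ g n
    expTerm≤g zero    = ≤-refl
    expTerm≤g (suc n) = begin
      expTerm (x + z) n * (x + z) * r ≤⟨ *-monoʳ (0≤1/ n) (*-monoʳ (0≤-+ 0≤x 0≤z) (expTerm≤g n)) ⟩
      g n * (x + z) * r               ≡⟨ cong (_* r) (*-comm (g n) (x + z)) ⟩
      (x + z) * g n * r               ≤⟨ *-monoʳ (0≤1/ n) (g-growth n) ⟩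
      ι (suc n) * g (suc n) * r       ≡⟨ solve 3 (λ i g r → i :* g :* r := (i :* r) :* g)
                                               refl (ι (suc n)) (g (suc n)) r ⟩
      ι (suc n) * r * g (suc n)       ≡⟨ cong (_* g (suc n)) (ι-/ 1 n) ⟩
      1ℚ * g (suc n)                  ≡⟨ *-identityˡ _ ⟩
      g (suc n)                       ∎
      where
      open +-*-Solver
      r = + 1 / suc n

    G : ℕ → ℚ
    G zero    = 0ℚ
    G (suc n) = G n + g n

    expSum≤G : ∀ n → expSum (x + z) n ≤ G n
    expSum≤G zero    = ≤-refl
    expSum≤G (suc n) = +-mono-≤ (expSum≤G n) (expTerm≤g n)

    -- The identity `(1 - z) · G = exp x` for truncated series, arranged without subtraction;
    -- `z * g n` is the error of truncation.
    G-suc : ∀ n → G (suc n) + z * g n ≡ z * G (suc n) + expSum x (suc n)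
    G-suc zero = solve 1 (λ z → (con 0ℚ :+ con 1ℚ) :+ z :* con 1ℚ :=
                                z :* (con 0ℚ :+ con 1ℚ) :+ (con 0ℚ :+ con 1ℚ)) refl z
      where open +-*-Solver
    G-suc (suc n) = begin-equality
      G (suc n) + g (suc n) + z * g (suc n)
        ≡⟨ solve 4 (λ G z g e → G :+ (z :* g :+ e) :+ z :* (z :* g :+ e) :=
                                (G :+ z :* g) :+ (e :+ z :* (z :* g :+ e)))
                 refl (G (suc n)) z (g n) e ⟩
      G (suc n) + z * g n + (e + z * g (suc n))
        ≡⟨ cong (_+ (e + z * g (suc n))) (G-suc n) ⟩
      z * G (suc n) + expSum x (suc n) + (e + z * g (suc n))
        ≡⟨ solve 5 (λ z G E e g → z :* G :+ E :+ (e :+ z :* g) := z :* (G :+ g) :+ (E :+ e))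
                 refl z (G (suc n)) (expSum x (suc n)) e (g (suc n)) ⟩
      z * (G (suc n) + g (suc n)) + (expSum x (suc n) + e) ∎
      where
      open +-*-Solver
      e = expTerm x (suc n)

  -- With `z = 1 / suc p` one has `p / suc p = 1 - z`, so this is `exp (x + z) ≤ exp x / (1 - z)`
  -- with the denominators cleared.
  expSum-shift : ∀ {x} p → 0ℚ ≤ x → ∀ n →
                 ι p * expSum (x + + 1 / suc p) n ≤ ι (suc p) * expSum x n
  expSum-shift p 0≤x zero    = ≤-reflexive (trans (*-zeroʳ (ι p)) (sym (*-zeroʳ (ι (suc p)))))
  expSum-shift {x} p 0≤x (suc n) = begin
    ι p * expSum (x + z) (suc n)   ≤⟨ *-monoˡ (0≤ι p) (expSum≤G (suc n)) ⟩
    ι p * G (suc n)                ≡⟨ +-identityʳ _ ⟨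
    ι p * G (suc n) + 0ℚ           ≤⟨ +-monoʳ-≤ (ι p * G (suc n)) (0≤g n) ⟩
    ι p * G (suc n) + g n          ≡⟨ cancelled ⟩
    ι (suc p) * expSum x (suc n)   ∎
    where
    z = + 1 / suc p
    open Shift 0≤x (0≤1/ p)
    open +-*-Solver
    Q = ι (suc p)
    cancelled : ι p * G (suc n) + g n ≡ Q * expSum x (suc n)
    cancelled = begin-equality
      ι p * G (suc n) + g n
        ≡⟨ solve 3 (λ P G g → P :* G :+ g := ((con 1ℚ :+ P) :* G :+ con 1ℚ :* g) :- con 1ℚ :* G)
                 refl (ι p) (G (suc n)) (g n) ⟩
      ((1ℚ + ι p) * G (suc n) + 1ℚ * g n) - 1ℚ * G (suc n)
        ≡⟨ cong₂ (λ q u → (q * G (suc n) + u * g n) - u * G (suc n)) (ι-suc p) (ι-/ 1 p) ⟨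
      (Q * G (suc n) + Q * z * g n) - Q * z * G (suc n)
        ≡⟨ solve 4 (λ Q z G g → (Q :* G :+ Q :* z :* g) :- Q :* z :* G :=
                                Q :* (G :+ z :* g) :- Q :* z :* G)
                 refl Q z (G (suc n)) (g n) ⟩
      Q * (G (suc n) + z * g n) - Q * z * G (suc n)
        ≡⟨ cong (λ y → Q * y - Q * z * G (suc n)) (G-suc n) ⟩
      Q * (z * G (suc n) + expSum x (suc n)) - Q * z * G (suc n)
        ≡⟨ solve 4 (λ Q z G E → Q :* (z :* G :+ E) :- Q :* z :* G := Q :* E)
                 refl Q z (G (suc n)) (expSum x (suc n)) ⟩
      Q * expSum x (suc n) ∎

  shift : ℕ → ℕ → ℚ → ℚ
  shift p zero    x = x
  shift p (suc t) x = shift p t x + + 1 / suc p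

  0≤shift : ∀ p t {x} → 0ℚ ≤ x → 0ℚ ≤ shift p t x
  0≤shift p zero    0≤x = 0≤x
  0≤shift p (suc t) 0≤x = 0≤-+ (0≤shift p t 0≤x) (0≤1/ p)

  shift-scaled : ∀ p t x → ι (suc p) * shift p t x ≡ ι (suc p) * x + ι t
  shift-scaled p zero    x = sym (+-identityʳ _)
  shift-scaled p (suc t) x = begin-equality
    ι (suc p) * (shift p t x + + 1 / suc p)
      ≡⟨ *-distribˡ-+ (ι (suc p)) _ _ ⟩
    ι (suc p) * shift p t x + ι (suc p) * (+ 1 / suc p)
      ≡⟨ cong₂ _+_ (shift-scaled p t x) (ι-/ 1 p) ⟩
    ι (suc p) * x + ι t + 1ℚ
      ≡⟨ solve 2 (λ a b → a :+ b :+ con 1ℚ := a :+ (con 1ℚ :+ b)) refl (ι (suc p) * x) (ι t) ⟩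
    ι (suc p) * x + (1ℚ + ι t)
      ≡⟨ cong (_+_ (ι (suc p) * x)) (ι-suc t) ⟨
    ι (suc p) * x + ι (suc t) ∎
    where open +-*-Solver

  expSum-shifts : ∀ p t {x} → 0ℚ ≤ x → ∀ n →
                  ι (p ℕ.^ t) * expSum (shift p t x) n ≤ ι (suc p ℕ.^ t) * expSum x n
  expSum-shifts p zero    0≤x n = ≤-refl
  expSum-shifts p (suc t) {x} 0≤x n = begin
    ι (p ℕ.* p ℕ.^ t) * E′
      ≡⟨ cong (λ i → ι i * E′) (ℕₚ.*-comm p (p ℕ.^ t)) ⟩
    ι (p ℕ.^ t ℕ.* p) * E′
      ≡⟨ cong (_* E′) (ι-* (p ℕ.^ t) p) ⟩
    ι (p ℕ.^ t) * ι p * E′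
      ≡⟨ *-assoc (ι (p ℕ.^ t)) (ι p) E′ ⟩
    ι (p ℕ.^ t) * (ι p * E′)
      ≤⟨ *-monoˡ (0≤ι (p ℕ.^ t)) (expSum-shift p (0≤shift p t 0≤x) n) ⟩
    ι (p ℕ.^ t) * (ι (suc p) * E)
      ≡⟨ *-swap (ι (p ℕ.^ t)) (ι (suc p)) E ⟩
    ι (suc p) * (ι (p ℕ.^ t) * E)
      ≤⟨ *-monoˡ (0≤ι (suc p)) (expSum-shifts p t 0≤x n) ⟩
    ι (suc p) * (ι (suc p ℕ.^ t) * expSum x n)
      ≡⟨ *-assoc (ι (suc p)) (ι (suc p ℕ.^ t)) (expSum x n) ⟨
    ι (suc p) * ι (suc p ℕ.^ t) * expSum x n
      ≡⟨ cong (_* expSum x n) (ι-* (suc p) (suc p ℕ.^ t)) ⟨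
    ι (suc p ℕ.* suc p ℕ.^ t) * expSum x n ∎
    where
    E  = expSum (shift p t x) n
    E′ = expSum (shift p t x + + 1 / suc p) n

  expSum-0 : ∀ n → expSum 0ℚ n ≤ 1ℚ
  expSum-0 zero          = 0≤ι 1
  expSum-0 (suc zero)    = ≤-refl
  expSum-0 (suc (suc n)) = begin
    expSum 0ℚ (suc n) + expTerm 0ℚ n * 0ℚ * (+ 1 / suc n)
      ≡⟨ solve 3 (λ E e r → E :+ e :* con 0ℚ :* r := E)
               refl (expSum 0ℚ (suc n)) (expTerm 0ℚ n) (+ 1 / suc n) ⟩
    expSum 0ℚ (suc n)
      ≤⟨ expSum-0 (suc n) ⟩
    1ℚ ∎
    where open +-*-Solver

  -- The logarithm is estimated by a sum of two kinds of small steps: t steps of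
  -- 1 / (2k), for 2k = suc p, and three steps of 1 / 6, which make up 1 / 2.
  ≤-·ln-half : ∀ c k t m p → suc p ≡ 2 ℕ.* k → c ℕ.≤ t ℕ.+ k →
               2 ℕ.* ((2 ℕ.* k) ℕ.^ t ℕ.* 6 ℕ.^ 3) ℕ.≤ p ℕ.^ t ℕ.* 5 ℕ.^ 3 ℕ.* m →
               0 ℕ.< p ℕ.^ t → c ≤ 2 ℕ.* k ·ln (+ m / 2)
  ≤-·ln-half c k t m p p≡ c≤ pow 0<p^t = x , (0≤x , bounded) , (begin
    ι c                          ≤⟨ ι-mono c≤ ⟩
    ι (t ℕ.+ k)                  ≡⟨ trans (cong ι (ℕₚ.+-comm t k)) (ι-+ k t) ⟩
    ι k + ι t                    ≡⟨ cong (_+ ι t) halfway ⟨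
    ι (suc p) * ½′ + ι t         ≡⟨ shift-scaled p t ½′ ⟨
    ι (suc p) * x                ≡⟨ cong (λ a → ι a * x) p≡ ⟩
    ι (2 ℕ.* k) * x              ∎)
    where
    ½′ = shift 5 3 0ℚ
    x = shift p t ½′
    0≤x : 0ℚ ≤ x
    0≤x = 0≤shift p t (0≤shift 5 3 ≤-refl)
    halfway : ι (suc p) * ½′ ≡ ι k
    halfway = begin-equality
      ι (suc p) * ½′    ≡⟨ cong (λ a → ι a * ½′) (trans p≡ (ℕₚ.*-comm 2 k)) ⟩
      ι (k ℕ.* 2) * ½′  ≡⟨ cong (_* ½′) (ι-* k 2) ⟩
      -- `½′` is a closed rational, and `ι 2 * ½′` evaluates to `1ℚ`.
      ι k * ι 2 * ½′    ≡⟨ *-assoc (ι k) (ι 2) ½′ ⟩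
      ι k * 1ℚ          ≡⟨ *-identityʳ (ι k) ⟩
      ι k               ∎
    a = p ℕ.^ t ℕ.* 5 ℕ.^ 3
    b = suc p ℕ.^ t ℕ.* 6 ℕ.^ 3
    instance
      a-pos : Positive (ι a)
      a-pos = positive (<-≤-trans (positive⁻¹ 1ℚ) (ι-mono (ℕₚ.*-mono-≤ 0<p^t (ℕₚ.m^n>0 5 3))))
    aE≤b : ∀ n → ι a * expSum x n ≤ ι b
    aE≤b n = begin
      ι (p ℕ.^ t ℕ.* 5 ℕ.^ 3) * expSum x n
        ≡⟨ cong (λ i → ι i * expSum x n) (ℕₚ.*-comm (p ℕ.^ t) (5 ℕ.^ 3)) ⟩
      ι (5 ℕ.^ 3 ℕ.* p ℕ.^ t) * expSum x n
        ≡⟨ cong (_* expSum x n) (ι-* (5 ℕ.^ 3) (p ℕ.^ t)) ⟩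
      ι (5 ℕ.^ 3) * ι (p ℕ.^ t) * expSum x n
        ≡⟨ *-assoc (ι (5 ℕ.^ 3)) (ι (p ℕ.^ t)) (expSum x n) ⟩
      ι (5 ℕ.^ 3) * (ι (p ℕ.^ t) * expSum x n)
        ≤⟨ *-monoˡ (0≤ι (5 ℕ.^ 3)) (expSum-shifts p t (0≤shift 5 3 ≤-refl) n) ⟩
      ι (5 ℕ.^ 3) * (ι (suc p ℕ.^ t) * expSum ½′ n)
        ≡⟨ *-swap (ι (5 ℕ.^ 3)) (ι (suc p ℕ.^ t)) (expSum ½′ n) ⟩
      ι (suc p ℕ.^ t) * (ι (5 ℕ.^ 3) * expSum ½′ n)
        ≤⟨ *-monoˡ (0≤ι (suc p ℕ.^ t)) (expSum-shifts 5 3 ≤-refl n) ⟩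
      ι (suc p ℕ.^ t) * (ι (6 ℕ.^ 3) * expSum 0ℚ n)
        ≤⟨ *-monoˡ (0≤ι (suc p ℕ.^ t)) (*-monoˡ (0≤ι (6 ℕ.^ 3)) (expSum-0 n)) ⟩
      ι (suc p ℕ.^ t) * (ι (6 ℕ.^ 3) * 1ℚ)
        ≡⟨ cong (ι (suc p ℕ.^ t) *_) (*-identityʳ (ι (6 ℕ.^ 3))) ⟩
      ι (suc p ℕ.^ t) * ι (6 ℕ.^ 3)
        ≡⟨ ι-* (suc p ℕ.^ t) (6 ℕ.^ 3) ⟨
      ι (suc p ℕ.^ t ℕ.* 6 ℕ.^ 3) ∎
    bounded : ∀ n → expSum x n ≤ + m / 2
    bounded n = *-cancelˡ-≤-pos (ι 2) (*-cancelˡ-≤-pos (ι a) (begin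
      ι a * (ι 2 * expSum x n)     ≡⟨ *-swap (ι a) (ι 2) (expSum x n) ⟩
      ι 2 * (ι a * expSum x n)     ≤⟨ *-monoˡ (0≤ι 2) (aE≤b n) ⟩
      ι 2 * ι b                    ≡⟨ ι-* 2 b ⟨
      ι (2 ℕ.* b)                  ≡⟨ cong (λ q → ι (2 ℕ.* (q ℕ.^ t ℕ.* 6 ℕ.^ 3))) p≡ ⟩
      ι (2 ℕ.* ((2 ℕ.* k) ℕ.^ t ℕ.* 6 ℕ.^ 3)) ≤⟨ ι-mono pow ⟩
      ι (a ℕ.* m)                  ≡⟨ ι-* a m ⟩
      ι a * ι m                    ≡⟨ cong (ι a *_) (ι-/ m 1) ⟨
      ι a * (ι 2 * (+ m / 2))      ∎))

open Logarithm using (≤-·ln-half)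

open import Data.Nat hiding (_/_)
open import Data.Nat.Properties
open import Data.Nat.Solver using (module +-*-Solver)
open import Data.Rational using (_/_)

-- Running time of programs with bounded recursion depth

^-distrib-* : ∀ a b t → (a * b) ^ t ≡ a ^ t * b ^ t
^-distrib-* a b zero    = refl
^-distrib-* a b (suc t) = trans (cong (a * b *_) (^-distrib-* a b t))
  (solve 4 (λ a b x y → a :* b :* (x :* y) := a :* x :* (b :* y)) refl a b (a ^ t) (b ^ t))
  where open +-*-Solver

isLevel : ∀ {F} → ℕ → Fin F → ℕ
isLevel ℓ f with toℕ f ≟ ℓ
... | yes _ = 1
... | no _  = 0

module ExpMeasures {F : ℕ} {arity : Fin F → ℕ} where

  mutual
    expSize : ∀ {n} → Exp arity n → ℕ
    expSize (var i)        = 1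
    expSize nil            = 1
    expSize (cons e₁ e₂)   = 1 + expSize e₁ + expSize e₂
    expSize (case e e₀ e₁) = 1 + expSize e + (expSize e₀ + expSize e₁)
    expSize (call f es)    = 2 + expsSize es

    expsSize : ∀ {n k} → Vec (Exp arity n) k → ℕ
    expsSize []       = 0
    expsSize (e ∷ es) = expSize e + expsSize es

  mutual
    -- What matters is how many self-calls a single evaluation can make; only one branch of a `case`
    -- runs, hence the maximum.
    selfCalls : ℕ → ∀ {n} → Exp arity n → ℕ
    selfCalls ℓ (var i)        = 0
    selfCalls ℓ nil            = 0
    selfCalls ℓ (cons e₁ e₂)   = selfCalls ℓ e₁ + selfCalls ℓ e₂
    selfCalls ℓ (case e e₀ e₁) = selfCalls ℓ e + (selfCalls ℓ e₀ ⊔ selfCalls ℓ e₁)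
    selfCalls ℓ (call f es)    = isLevel ℓ f + selfCalls* ℓ es

    selfCalls* : ℕ → ∀ {n k} → Vec (Exp arity n) k → ℕ
    selfCalls* ℓ []       = 0
    selfCalls* ℓ (e ∷ es) = selfCalls ℓ e + selfCalls* ℓ es

open ExpMeasures

module Budgeted (P : Program) (N : ℕ) where
  open Program P
  open Semantics P

  -- Eval ℓ k ρ e v: in the environment ρ, inside the body of the function
  -- number ℓ, e evaluates to v, the self-calls being nested at most k deep and
  -- every call of a function of smaller number nesting its own at most N deep.
  mutual
    data Eval (ℓ : ℕ) {n : ℕ} (ρ : Vec Tree n) : ℕ → Exp arity n → Tree → Set where
      var : ∀ {k i} → Eval ℓ ρ k (var i) (lookup ρ i)
      nil : ∀ {k} → Eval ℓ ρ k nil nil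
      cons : ∀ {k e₁ e₂ v₁ v₂} →
             Eval ℓ ρ k e₁ v₁ → Eval ℓ ρ k e₂ v₂ → Eval ℓ ρ k (cons e₁ e₂) (v₁ ∙ v₂)
      case-nil : ∀ {k e e₀ e₁ v} →
                 Eval ℓ ρ k e nil → Eval ℓ ρ k e₀ v → Eval ℓ ρ k (case e e₀ e₁) v
      case-cons : ∀ {k e e₀ e₁ l r v} →
                  Eval ℓ ρ k e (l ∙ r) → Eval ℓ (l ∷ r ∷ ρ) k e₁ v →
                  Eval ℓ ρ k (case e e₀ e₁) v
      -- As a boolean test, the side condition reduces to the unit type for concrete functions and
      -- is then filled in silently.
      lower : ∀ {k g es vs v} {_ : T (toℕ g <ᵇ ℓ)} →
              Evals ℓ ρ k es vs → Run g N vs v → Eval ℓ ρ k (call g es) v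
      self : ∀ {k f es vs v} {_ : T (toℕ f ≡ᵇ ℓ)} →
             Evals ℓ ρ (suc k) es vs → Eval ℓ vs k (body f) v →
             Eval ℓ ρ (suc k) (call f es) v

    data Evals (ℓ : ℕ) {n : ℕ} (ρ : Vec Tree n) (k : ℕ) :
               ∀ {j} → Vec (Exp arity n) j → Vec Tree j → Set where
      []  : Evals ℓ ρ k [] []
      _∷_ : ∀ {j e v} {es : Vec (Exp arity n) j} {vs} →
            Eval ℓ ρ k e v → Evals ℓ ρ k es vs → Evals ℓ ρ k (e ∷ es) (v ∷ vs)

    Run : (f : Fin F) → ℕ → Vec Tree (arity f) → Tree → Set
    Run f k vs v = Eval (toℕ f) vs k (body f) v

  module Timing (S : ℕ) (body-size : ∀ f → expSize (body f) ≤ S)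
                (linear : ∀ f → selfCalls (toℕ f) (body f) ≤ 1) where

    -- One level of the hierarchy runs at most `suc N` nested bodies of at most `S` nodes each;
    -- `suc S` instead of `S` leaves room for the extra unit in `cost-run`.
    factor : ℕ
    factor = suc S * suc N

    -- An upper bound for one more than the time of any call of a function of
    -- number below ℓ.
    X : ℕ → ℕ
    X ℓ = factor ^ ℓ

    1≤X : ∀ ℓ → 1 ≤ X ℓ
    1≤X ℓ = m^n>0 factor ℓ

    -- Abstract, so that the two coefficients can be inferred from the bound.
    abstract
      bound : ℕ → ℕ → ℕ → ℕ → ℕ
      bound ℓ k size calls = size * X ℓ + calls * (k * (S * X ℓ))

      X≤bound : ∀ ℓ k → X ℓ ≤ bound ℓ k 1 0
      X≤bound ℓ k = ≤-trans (m≤m+n (X ℓ) 0) (m≤m+n _ 0)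

      self≤bound : ∀ ℓ k → k * (S * X ℓ) ≤ bound ℓ k 1 1
      self≤bound ℓ k = ≤-trans (m≤m+n _ 0) (m≤n+m _ (X ℓ + 0))

      bound-body : ∀ ℓ k → bound ℓ k S 1 ≡ suc k * (S * X ℓ)
      bound-body ℓ k = cong (_+_ (S * X ℓ)) (+-identityʳ _)

      bound-no-calls : ∀ ℓ k a → bound ℓ k a 0 ≡ a * X ℓ
      bound-no-calls ℓ k a = +-identityʳ _

      bound-+ : ∀ ℓ k a b c d → bound ℓ k a c + bound ℓ k b d ≡ bound ℓ k (a + b) (c + d)
      bound-+ ℓ k a b c d =
        solve 6 (λ a b c d x y → (a :* x :+ c :* y) :+ (b :* x :+ d :* y)
                               := (a :+ b) :* x :+ (c :+ d) :* y)
              refl a b c d (X ℓ) (k * (S * X ℓ))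
        where open +-*-Solver

      bound-mono : ∀ ℓ k {a b c d} → a ≤ b → c ≤ d → bound ℓ k a c ≤ bound ℓ k b d
      bound-mono ℓ k a≤b c≤d =
        +-mono-≤ (*-monoˡ-≤ (X ℓ) a≤b) (*-monoˡ-≤ (k * (S * X ℓ)) c≤d)

    1≤bound : ∀ ℓ k → 1 ≤ bound ℓ k 1 0
    1≤bound ℓ k = ≤-trans (1≤X ℓ) (X≤bound ℓ k)

    step : ∀ ℓ k {a b c d t u} → t ≤ bound ℓ k a c → u ≤ bound ℓ k b d →
           1 + t + u ≤ bound ℓ k (1 + a + b) (c + d)
    step ℓ k {a} {b} {c} {d} {t} {u} t≤ u≤ = begin
      1 + t + u                                     ≤⟨ +-mono-≤ (+-mono-≤ (1≤bound ℓ k) t≤) u≤ ⟩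
      bound ℓ k 1 0 + bound ℓ k a c + bound ℓ k b d ≡⟨ cong (_+ bound ℓ k b d) (bound-+ ℓ k 1 a 0 c) ⟩
      bound ℓ k (1 + a) c + bound ℓ k b d           ≡⟨ bound-+ ℓ k (1 + a) b c d ⟩
      bound ℓ k (1 + a + b) (c + d)                 ∎
      where open ≤-Reasoning

    -- A call in the body of function ℓ counts as two nodes: one for the call
    -- itself and one for a callee of smaller number.
    call-lower : ∀ ℓ k j {a c t u} → t ≤ bound ℓ k a c → suc u ≤ X ℓ →
                 1 + t + u ≤ bound ℓ k (2 + a) (j + c)
    call-lower ℓ k j {a} {c} {t} {u} t≤ u< = begin
      1 + t + u                         ≡⟨ cong suc (+-comm t u) ⟩
      suc u + t                         ≤⟨ +-mono-≤ (≤-trans u< X≤) t≤ ⟩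
      bound ℓ k 2 0 + bound ℓ k a c     ≡⟨ bound-+ ℓ k 2 a 0 c ⟩
      bound ℓ k (2 + a) c               ≤⟨ bound-mono ℓ k ≤-refl (m≤n+m c j) ⟩
      bound ℓ k (2 + a) (j + c)         ∎
      where
      open ≤-Reasoning
      X≤ : X ℓ ≤ bound ℓ k 2 0
      X≤ = ≤-trans (X≤bound ℓ k) (bound-mono ℓ k (s≤s z≤n) z≤n)

    call-self : ∀ ℓ k {a c t u} → t ≤ bound ℓ (suc k) a c → u ≤ suc k * (S * X ℓ) →
                1 + t + u ≤ bound ℓ (suc k) (2 + a) (1 + c)
    call-self ℓ k {a} {c} {t} {u} t≤ u≤ = begin
      1 + t + u                                       ≤⟨ +-monoʳ-≤ (1 + t) (≤-trans u≤ (self≤bound ℓ (suc k))) ⟩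
      1 + t + bound ℓ (suc k) 1 1                     ≤⟨ step ℓ (suc k) t≤ ≤-refl ⟩
      bound ℓ (suc k) (1 + a + 1) (c + 1)             ≡⟨ cong₂ (bound ℓ (suc k)) (+-comm (1 + a) 1) (+-comm c 1) ⟩
      bound ℓ (suc k) (2 + a) (1 + c)                 ∎
      where open ≤-Reasoning

    mutual
      -- Induction on the derivation: the nodes are charged `X ℓ` each, which also pays for callees
      -- of smaller number, and a self-call is charged all the bodies nested below it. Since a body
      -- makes at most one self-call, these charges form a chain and not a tree.
      cost : ∀ {ℓ k n} {ρ : Vec Tree n} {e v} → Eval ℓ ρ k e v →
             ∃[ t ] (ρ ⊢ e ⇓ v [ t ] × t ≤ bound ℓ k (expSize e) (selfCalls ℓ e))
      cost {ℓ} {k} (var {i = i}) = 1 , var i , 1≤bound ℓ k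
      cost {ℓ} {k} nil = 1 , nil , 1≤bound ℓ k
      cost {ℓ} {k} (cons d₁ d₂) with cost d₁ | cost d₂
      ... | t₁ , D₁ , t₁≤ | t₂ , D₂ , t₂≤ = _ , cons D₁ D₂ , step ℓ k t₁≤ t₂≤
      cost {ℓ} {k} (case-nil d d₀) with cost d | cost d₀
      ... | t , D , t≤ | t₀ , D₀ , t₀≤ =
        _ , case-nil D D₀ ,
        step ℓ k t≤ (≤-trans t₀≤ (bound-mono ℓ k (m≤m+n _ _) (m≤m⊔n _ _)))
      cost {ℓ} {k} (case-cons d d₁) with cost d | cost d₁
      ... | t , D , t≤ | t₁ , D₁ , t₁≤ =
        _ , case-cons D D₁ ,
        step ℓ k t≤ (≤-trans t₁≤ (bound-mono ℓ k (m≤n+m _ _) (m≤n⊔m _ _)))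
      cost {ℓ} {k} (lower {g = g} {_} {_} {_} {g<ℓ} ds d) with costs ds | cost-run g d
      ... | t , D , t≤ | u , E , u< =
        _ , call D E ,
        call-lower ℓ k (isLevel ℓ g) t≤ (≤-trans u< (^-monoʳ-≤ factor (<ᵇ⇒< (toℕ g) ℓ g<ℓ)))
      cost {ℓ} (self {k} {f} {_} {_} {_} {f≡ℓ} ds d) with ≡ᵇ⇒≡ (toℕ f) ℓ f≡ℓ
      ... | refl with costs ds | cost-body f d
      ... | t , D , t≤ | u , E , u≤ with toℕ f ≟ toℕ f
      ... | yes _  = _ , call D E , call-self ℓ k t≤ u≤
      ... | no f≢f with () ← f≢f refl

      costs : ∀ {ℓ k n j} {ρ : Vec Tree n} {es : Vec (Exp arity n) j} {vs} → Evals ℓ ρ k es vs →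
              ∃[ t ] (ρ ⊢* es ⇓ vs [ t ] × t ≤ bound ℓ k (expsSize es) (selfCalls* ℓ es))
      costs [] = 0 , [] , z≤n
      costs {ℓ} {k} {es = e ∷ es} (d ∷ ds) with cost d | costs ds
      ... | t , D , t≤ | u , E , u≤ =
        _ , D ∷ E ,
        ≤-trans (+-mono-≤ t≤ u≤)
          (≤-reflexive (bound-+ ℓ k (expSize e) (expsSize es) (selfCalls ℓ e) (selfCalls* ℓ es)))

      cost-body : ∀ f {k vs v} → Run f k vs v →
                  ∃[ t ] (vs ⊢ body f ⇓ v [ t ] × t ≤ suc k * (S * X (toℕ f)))
      cost-body f {k} d with cost d
      ... | t , D , t≤ =
        t , D , ≤-trans t≤ (≤-trans (bound-mono (toℕ f) k (body-size f) (linear f))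
                                    (≤-reflexive (bound-body (toℕ f) k)))

      cost-run : ∀ f {vs v} → Run f N vs v →
                 ∃[ t ] (vs ⊢ body f ⇓ v [ t ] × suc t ≤ X (suc (toℕ f)))
      cost-run f d with cost-body f d
      ... | t , D , t≤ = t , D , (begin
        suc t
          ≤⟨ s≤s t≤ ⟩
        1 + suc N * (S * X ℓ)
          ≤⟨ +-monoˡ-≤ (suc N * (S * X ℓ)) (*-mono-≤ {1} {suc N} (s≤s z≤n) (1≤X ℓ)) ⟩
        suc N * X ℓ + suc N * (S * X ℓ)
          ≡⟨ solve 3 (λ n s x → n :* x :+ n :* (s :* x) := (con 1 :+ s) :* n :* x)
                   refl (suc N) S (X ℓ) ⟩
        X (suc ℓ) ∎)
        where
        open ≤-Reasoning
        open +-*-Solver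
        ℓ = toℕ f

    -- The main expression is treated as the body of a function numbered above all others, so that
    -- each of its calls is a `lower` one. Every level contributes a factor quadratic in `n`, hence
    -- the exponent `2 * ℓ`.
    cost-polynomial : ∀ ℓ n {j} {ρ : Vec Tree j} {e v} → suc N ≤ 3 * (n * n) →
                      expSize e ≤ S → selfCalls ℓ e ≡ 0 → Eval ℓ ρ 0 e v →
                      ∃[ t ] (ρ ⊢ e ⇓ v [ t ] × t ≤ S * (3 * suc S) ^ ℓ * n ^ (2 * ℓ))
    cost-polynomial ℓ n {e = e} N<3n² e≤S no-calls d with cost d
    ... | t , D , t≤ rewrite no-calls = t , D , (begin
      t                                      ≤⟨ t≤ ⟩
      bound ℓ 0 (expSize e) 0                ≡⟨ bound-no-calls ℓ 0 (expSize e) ⟩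
      expSize e * (suc S * suc N) ^ ℓ        ≤⟨ *-mono-≤ e≤S (^-monoˡ-≤ ℓ (*-monoʳ-≤ (suc S) N<3n²)) ⟩
      S * (suc S * (3 * (n * n))) ^ ℓ        ≡⟨ cong (λ x → S * x ^ ℓ) regroup ⟩
      S * (3 * suc S * n ^ 2) ^ ℓ            ≡⟨ cong (S *_) (^-distrib-* (3 * suc S) (n ^ 2) ℓ) ⟩
      S * ((3 * suc S) ^ ℓ * (n ^ 2) ^ ℓ)    ≡⟨ cong (λ x → S * ((3 * suc S) ^ ℓ * x)) (^-*-assoc n 2 ℓ) ⟩
      S * ((3 * suc S) ^ ℓ * n ^ (2 * ℓ))    ≡⟨ *-assoc S ((3 * suc S) ^ ℓ) (n ^ (2 * ℓ)) ⟨
      S * (3 * suc S) ^ ℓ * n ^ (2 * ℓ)      ∎)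
      where
      open ≤-Reasoning
      open +-*-Solver
      regroup : suc S * (3 * (n * n)) ≡ 3 * suc S * n ^ 2
      regroup = solve 2 (λ a n → a :* (con 3 :* (n :* n)) := con 3 :* a :* (n :* (n :* con 1)))
                      refl (suc S) n

-- The algorithm and its program

smaller : {A : Set} → (A → ℕ) → A → A → A
smaller size x y = if size x ≤ᵇ size y then x else y

module SetCover {X E : Set} (covers : X → E → Bool) where

  residual : List E → X → List E
  residual []      w = []
  residual (e ∷ R) w = if covers w e then residual R w else e ∷ residual R w

  -- The dummy d, which is paired with all of R, loses against every string
  -- which covers something.
  best : List E → X → List X → X × List E
  best R d []       = d , R
  best R d (w ∷ ws) = smaller (λ c → length (proj₂ c)) (w , residual R w) (best R d ws)

  -- The fuel makes the recursion structural. `length R` units suffice when `R` can be covered,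
  -- because then each choice covers something.
  greedy : X → List X → ℕ → List E → List X
  greedy d W zero    R           = []
  greedy d W (suc n) []          = []
  greedy d W (suc n) R@(_ ∷ _) =
    proj₁ (best R d W) ∷ greedy d W n (proj₂ (best R d W))

  seeded : X → List X → List E → List X → List X
  -- The unseeded run is the default at the end of the list; it yields a cover as well, so that
  -- every intermediate result is one.
  seeded d W U []       = greedy d W (length U) U
  seeded d W U (w ∷ ws) =
    smaller length (w ∷ greedy d W (length U) (residual U w)) (seeded d W U ws)

  length-residual : ∀ R w → length (residual R w) ≤ length R
  length-residual []      w = z≤n
  length-residual (e ∷ R) w with covers w e
  ... | true  = m≤n⇒m≤1+n (length-residual R w)
  ... | false = s≤s (length-residual R w)

  length-best : ∀ R d ws → length (proj₂ (best R d ws)) ≤ length R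
  length-best R d []       = ≤-refl
  length-best R d (w ∷ ws) with length (residual R w) ≤ᵇ length (proj₂ (best R d ws))
  ... | true  = length-residual R w
  ... | false = length-best R d ws

  length-greedy : ∀ d W n R → length (greedy d W n R) ≤ n
  length-greedy d W zero    R       = z≤n
  length-greedy d W (suc n) []      = z≤n
  length-greedy d W (suc n) (_ ∷ _) = s≤s (length-greedy d W n _)

-- Positions of a string are natural numbers; positions beyond its end carry 0.
nth : List Bool → ℕ → Bool
nth []       i       = false
nth (x ∷ xs) zero    = x
nth (x ∷ xs) (suc i) = nth xs i

Pair : Set
Pair = ℕ × ℕ

separates : ∀ {m} → BitString m → Pair → Bool
separates w (i , j) = nth (toList w) i ∧ not (nth (toList w) j)

-- The accumulator spares the program a function for concatenation.
zeroPairs : List Bool → ℕ → ℕ → List Pair → List Pair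
zeroPairs []          j i acc = acc
zeroPairs (false ∷ t) j i acc = (i , j) ∷ zeroPairs t (suc j) i acc
zeroPairs (true ∷ t)  j i acc = zeroPairs t (suc j) i acc

onePairs : List Bool → ℕ → List Bool → List Pair
onePairs []          i s = []
onePairs (false ∷ t) i s = onePairs t (suc i) s
onePairs (true ∷ t)  i s = zeroPairs s 0 i (onePairs t (suc i) s)

universe : ∀ {m} → BitString m → List Pair
universe s = onePairs (toList s) 0 (toList s)

pattern v₀ = var zero
pattern v₁ = var (suc zero)
pattern v₂ = var (suc (suc zero))
pattern v₃ = var (suc (suc (suc zero)))
pattern v₄ = var (suc (suc (suc (suc zero))))
pattern v₅ = var (suc (suc (suc (suc (suc zero)))))
pattern v₆ = var (suc (suc (suc (suc (suc (suc zero))))))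
pattern v₇ = var (suc (suc (suc (suc (suc (suc (suc zero)))))))
pattern v₈ = var (suc (suc (suc (suc (suc (suc (suc (suc zero))))))))
pattern v₉ = var (suc (suc (suc (suc (suc (suc (suc (suc (suc zero)))))))))

-- The numbering is the call hierarchy: each body calls only functions listed before it, and itself.
pattern nthᶠ       = zero
pattern separatesᶠ = suc nthᶠ
pattern residualᶠ  = suc separatesᶠ
pattern zeroPairsᶠ = suc residualᶠ
pattern onePairsᶠ  = suc zeroPairsᶠ
pattern leqᶠ       = suc onePairsᶠ
pattern smallerᶠ   = suc leqᶠ
pattern bestᶠ      = suc smallerᶠ
pattern greedyᶠ    = suc bestᶠ
pattern seededᶠ    = suc greedyᶠ

arity : Fin 10 → ℕ
arity nthᶠ       = 2
arity separatesᶠ = 2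
arity residualᶠ  = 2
arity zeroPairsᶠ = 4
arity onePairsᶠ  = 3
arity leqᶠ       = 2
arity smallerᶠ   = 2
arity bestᶠ      = 3
arity greedyᶠ    = 4
arity seededᶠ    = 4

body : (f : Fin 10) → Exp arity (arity f)
body nthᶠ =
  case v₀ nil
    (case v₃ v₀
      (call nthᶠ (v₃ ∷ v₁ ∷ [])))
body separatesᶠ =
  case v₁ nil
    (case (call nthᶠ (v₂ ∷ v₀ ∷ [])) nil
      (case (call nthᶠ (v₄ ∷ v₃ ∷ [])) (cons nil nil) nil))
body residualᶠ =
  case v₀ nil
    (case (call separatesᶠ (v₃ ∷ v₀ ∷ []))
      (cons v₀ (call residualᶠ (v₁ ∷ v₃ ∷ [])))
      (call residualᶠ (v₃ ∷ v₅ ∷ [])))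
body zeroPairsᶠ =
  case v₀ v₃
    (case v₀
      (cons (cons v₄ v₃) (call zeroPairsᶠ (v₁ ∷ cons nil v₃ ∷ v₄ ∷ v₅ ∷ [])))
      (call zeroPairsᶠ (v₃ ∷ cons nil v₅ ∷ v₆ ∷ v₇ ∷ [])))
body onePairsᶠ =
  case v₀ nil
    (case v₀
      (call onePairsᶠ (v₁ ∷ cons nil v₃ ∷ v₄ ∷ []))
      (call zeroPairsᶠ (v₆ ∷ nil ∷ v₅ ∷ call onePairsᶠ (v₃ ∷ cons nil v₅ ∷ v₆ ∷ []) ∷ [])))
body leqᶠ =
  case v₀ (cons nil nil)
    (case v₃ nil
      (call leqᶠ (v₃ ∷ v₁ ∷ [])))
body smallerᶠ =
  case (call leqᶠ (v₀ ∷ v₁ ∷ [])) v₁ v₂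
body bestᶠ =
  case v₀ (cons v₂ v₁)
    (call smallerᶠ
      ( cons v₀ (call residualᶠ (v₃ ∷ v₀ ∷ []))
      ∷ call bestᶠ (v₁ ∷ v₃ ∷ v₄ ∷ []) ∷ []))
body greedyᶠ =
  case v₀ nil
    (case v₃ nil
      (case (call bestᶠ (v₆ ∷ v₅ ∷ v₇ ∷ [])) nil
        (cons v₀ (call greedyᶠ (v₅ ∷ v₁ ∷ v₈ ∷ v₉ ∷ [])))))
body seededᶠ =
  case v₀ (call greedyᶠ (v₁ ∷ v₁ ∷ v₂ ∷ v₃ ∷ []))
    (call smallerᶠ
      ( cons v₀ (call greedyᶠ (v₃ ∷ call residualᶠ (v₃ ∷ v₀ ∷ []) ∷ v₄ ∷ v₅ ∷ []))
      ∷ call seededᶠ (v₁ ∷ v₃ ∷ v₄ ∷ v₅ ∷ []) ∷ []))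

-- The universe also serves as the fuel of the greedy algorithm.
program : Program
program = record
  { F     = 10
  ; arity = arity
  ; body  = body
  ; main  = case v₀ nil (call seededᶠ (v₀ ∷ call onePairsᶠ (v₁ ∷ nil ∷ v₁ ∷ []) ∷ v₀ ∷ v₁ ∷ []))
  }

-- Evaluation of the program

maxSize : ℕ
maxSize = 40

body-size : ∀ f → expSize (body f) ≤ maxSize
body-size = toWitness {a? = all? λ f → expSize (body f) ≤? maxSize} _

linear : ∀ f → selfCalls (toℕ f) (body f) ≤ 1
linear = toWitness {a? = all? λ f → selfCalls (toℕ f) (body f) ≤? 1} _

-- The measure compared by `leqᶠ`. It lets `smallerᶠ` serve two purposes: the spine of an encoded
-- list is its length, and that of an encoded candidate is one more than the number of pairs it
-- leaves.
spine : Tree → ℕ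
spine nil     = 0
spine (l ∙ r) = suc (spine r)

spine-encodeList : {A : Set} (enc : A → Tree) (xs : List A) → spine (encodeList enc xs) ≡ length xs
spine-encodeList enc []       = refl
spine-encodeList enc (x ∷ xs) = cong suc (spine-encodeList enc xs)

unary : ℕ → Tree
unary zero    = nil
unary (suc n) = nil ∙ unary n

encodePair : Pair → Tree
encodePair (i , j) = unary i ∙ unary j

encodeBits : List Bool → Tree
encodeBits = encodeList encodeBit

encodePairs : List Pair → Tree
encodePairs = encodeList encodePair

module Correctness (N : ℕ) where
  open Budgeted program N

  nth-run : ∀ {k} xs i → length xs ≤ k →
            Run nthᶠ k (encodeBits xs ∷ unary i ∷ []) (encodeBit (nth xs i))
  nth-run []       i       _         = case-nil var nil
  nth-run (x ∷ xs) zero    _         = case-cons var (case-nil var var)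
  nth-run (x ∷ xs) (suc i) (s≤s len) =
    case-cons var (case-cons var (self (var ∷ var ∷ []) (nth-run xs i len)))

  zeroPairs-run : ∀ {k} t j i acc → length t ≤ k →
                  Run zeroPairsᶠ k (encodeBits t ∷ unary j ∷ unary i ∷ encodePairs acc ∷ [])
                    (encodePairs (zeroPairs t j i acc))
  zeroPairs-run []          j i acc _         = case-nil var var
  zeroPairs-run (false ∷ t) j i acc (s≤s len) =
    case-cons var (case-nil var (cons (cons var var)
      (self (var ∷ cons nil var ∷ var ∷ var ∷ []) (zeroPairs-run t (suc j) i acc len))))
  zeroPairs-run (true ∷ t)  j i acc (s≤s len) =
    case-cons var (case-cons var
      (self (var ∷ cons nil var ∷ var ∷ var ∷ []) (zeroPairs-run t (suc j) i acc len)))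

  onePairs-run : ∀ {k} t i s → length t ≤ k → length s ≤ N →
                 Run onePairsᶠ k (encodeBits t ∷ unary i ∷ encodeBits s ∷ [])
                   (encodePairs (onePairs t i s))
  onePairs-run []          i s _         _    = case-nil var nil
  onePairs-run (false ∷ t) i s (s≤s len) lenₛ =
    case-cons var (case-nil var
      (self (var ∷ cons nil var ∷ var ∷ []) (onePairs-run t (suc i) s len lenₛ)))
  onePairs-run (true ∷ t)  i s (s≤s len) lenₛ =
    case-cons var (case-cons var
      (lower
        (var ∷ nil ∷ var ∷
         self (var ∷ cons nil var ∷ var ∷ []) (onePairs-run t (suc i) s len lenₛ) ∷ [])
        (zeroPairs-run s 0 i (onePairs t (suc i) s) lenₛ)))

  leq-run : ∀ {k} t u → spine t ≤ k →
            Run leqᶠ k (t ∷ u ∷ []) (encodeBit (spine t ≤ᵇ spine u))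
  leq-run nil             u         _         = case-nil var (cons nil nil)
  leq-run (l ∙ r)         nil       _         = case-cons var (case-nil var nil)
  -- `suc a ≤ᵇ suc b` and `a ≤ᵇ b` reduce to the same boolean only once it is known whether `a` is
  -- zero, hence the split on the right subtree.
  leq-run (l ∙ nil)       (l′ ∙ r′) (s≤s len) =
    case-cons var (case-cons var (self (var ∷ var ∷ []) (leq-run nil r′ len)))
  leq-run (l ∙ r@(_ ∙ _)) (l′ ∙ r′) (s≤s len) =
    case-cons var (case-cons var (self (var ∷ var ∷ []) (leq-run r r′ len)))

  smaller-run : {A : Set} (enc : A → Tree) (size : A → ℕ) (x y : A) →
                (spine (enc x) ≤ᵇ spine (enc y)) ≡ (size x ≤ᵇ size y) →
                spine (enc x) ≤ N →
                Run smallerᶠ N (enc x ∷ enc y ∷ []) (enc (smaller size x y))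
  smaller-run enc size x y same len with size x ≤ᵇ size y | leq-run (enc x) (enc y) len
  ... | true  | d rewrite same = case-cons (lower (var ∷ var ∷ []) d) var
  ... | false | d rewrite same = case-nil (lower (var ∷ var ∷ []) d) var

  module Greedy {m : ℕ} (m≤N : m ≤ N) where
    open SetCover (separates {m})

    encodeStrings : List (BitString m) → Tree
    encodeStrings = encodeList encodeString

    length≤N : (w : BitString m) → length (toList w) ≤ N
    length≤N w = subst (_≤ N) (sym (length-toList w)) m≤N

    separates-run : ∀ {k} (w : BitString m) e →
                    Run separatesᶠ k (encodeString w ∷ encodePair e ∷ []) (encodeBit (separates w e))
    separates-run w (i , j)
      with nth (toList w) i | nth-run (toList w) i (length≤N w)
         | nth (toList w) j | nth-run (toList w) j (length≤N w)
    ... | false | p | _     | q =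
      case-cons var (case-nil (lower (var ∷ var ∷ []) p) nil)
    ... | true  | p | false | q =
      case-cons var (case-cons (lower (var ∷ var ∷ []) p)
        (case-nil (lower (var ∷ var ∷ []) q) (cons nil nil)))
    ... | true  | p | true  | q =
      case-cons var (case-cons (lower (var ∷ var ∷ []) p)
        (case-cons (lower (var ∷ var ∷ []) q) nil))

    residual-run : ∀ {k} R w → length R ≤ k →
                   Run residualᶠ k (encodePairs R ∷ encodeString w ∷ [])
                     (encodePairs (residual R w))
    residual-run []      w _         = case-nil var nil
    residual-run (e ∷ R) w (s≤s len) with separates w e | separates-run {N} w e
    ... | false | d = case-cons var (case-nil (lower (var ∷ var ∷ []) d)
                        (cons var (self (var ∷ var ∷ []) (residual-run R w len))))
    ... | true  | d = case-cons var (case-cons (lower (var ∷ var ∷ []) d)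
                        (self (var ∷ var ∷ []) (residual-run R w len)))

    encodeCandidate : BitString m × List Pair → Tree
    encodeCandidate (w , R) = encodeString w ∙ encodePairs R

    -- The budget exceeds `length R` by one because `leqᶠ` recurs along the spine of a candidate,
    -- where its string counts as one more node.
    best-run : ∀ {k} R d ws → length ws ≤ k → suc (length R) ≤ N →
               Run bestᶠ k (encodeStrings ws ∷ encodePairs R ∷ encodeString d ∷ [])
                 (encodeCandidate (best R d ws))
    best-run R d []       _         lenR = case-nil var (cons var var)
    best-run R d (w ∷ ws) (s≤s len) lenR =
      case-cons var
        (lower
          ( cons var (lower (var ∷ var ∷ []) (residual-run R w (<⇒≤ lenR)))
          ∷ self (var ∷ var ∷ var ∷ []) (best-run R d ws len lenR) ∷ [])
          (smaller-run encodeCandidate (λ c → length (proj₂ c)) (w , residual R w) (best R d ws)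
            (same (residual R w) (proj₂ (best R d ws)))
            (subst (λ n → suc n ≤ N) (sym (spine-encodeList encodePair (residual R w)))
              (≤-trans (s≤s (length-residual R w)) lenR))))
      where
      same : ∀ (P Q : List Pair) → (spine (encodePairs P) <ᵇ suc (spine (encodePairs Q))) ≡
                                   (length P ≤ᵇ length Q)
      same P Q rewrite spine-encodeList encodePair P | spine-encodeList encodePair Q with length P
      ... | zero  = refl
      ... | suc _ = refl

    greedy-run : ∀ {k} d W t R → spine t ≤ k → length W ≤ N → suc (length R) ≤ N →
                 Run greedyᶠ k (t ∷ encodePairs R ∷ encodeStrings W ∷ encodeString d ∷ [])
                   (encodeStrings (greedy d W (spine t) R))
    greedy-run d W nil     R           _          lenW lenR = case-nil var nil
    greedy-run d W (l ∙ t) []          _          lenW lenR = case-cons var (case-nil var nil)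
    greedy-run d W (l ∙ t) R@(_ ∷ _) (s≤s lent) lenW lenR =
      case-cons var (case-cons var
        (case-cons (lower (var ∷ var ∷ var ∷ []) (best-run R d W lenW lenR))
          (cons var (self (var ∷ var ∷ var ∷ var ∷ [])
            (greedy-run d W t _ lent lenW (≤-trans (s≤s (length-best R d W)) lenR))))))

    greedy-run′ : ∀ d W U R → length W ≤ N → suc (length U) ≤ N → length R ≤ length U →
                  Run greedyᶠ N
                    (encodePairs U ∷ encodePairs R ∷ encodeStrings W ∷ encodeString d ∷ [])
                    (encodeStrings (greedy d W (length U) R))
    greedy-run′ d W U R lenW lenU lenR
      with run ← greedy-run {N} d W (encodePairs U) R
      rewrite spine-encodeList encodePair U
      = run (<⇒≤ lenU) lenW (≤-trans (s≤s lenR) lenU)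

    seeded-run : ∀ {k} d W U ws → length ws ≤ k → length W ≤ N → suc (length U) ≤ N →
                 Run seededᶠ k
                   (encodeStrings ws ∷ encodePairs U ∷ encodeStrings W ∷ encodeString d ∷ [])
                   (encodeStrings (seeded d W U ws))
    seeded-run d W U []       _         lenW lenU =
      case-nil var (lower (var ∷ var ∷ var ∷ var ∷ []) (greedy-run′ d W U U lenW lenU ≤-refl))
    seeded-run d W U (w ∷ ws) (s≤s len) lenW lenU =
      case-cons var
        (lower
          ( cons var (lower
              (var ∷ lower (var ∷ var ∷ []) (residual-run U w (<⇒≤ lenU)) ∷ var ∷ var ∷ [])
              (greedy-run′ d W U (residual U w) lenW lenU (length-residual U w)))
          ∷ self (var ∷ var ∷ var ∷ var ∷ []) (seeded-run d W U ws len lenW lenU) ∷ [])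
          (smaller-run encodeStrings length seed (seeded d W U ws) same
            (subst (_≤ N) (sym (spine-encodeList encodeString seed))
              (≤-trans (s≤s (length-greedy d W (length U) _)) lenU))))
      where
      seed = w ∷ greedy d W (length U) (residual U w)
      same : (spine (encodeStrings seed) ≤ᵇ spine (encodeStrings (seeded d W U ws))) ≡
             (length seed ≤ᵇ length (seeded d W U ws))
      same = cong₂ _≤ᵇ_ (spine-encodeList encodeString seed)
                        (spine-encodeList encodeString (seeded d W U ws))

  -- The level 10 lies above all ten functions. The dummy string is `s` itself, which is at hand and
  -- has the right length.
  main-run : ∀ {m} (W : List (BitString m)) (s : BitString m) →
             m ≤ N → length W ≤ N → suc (length (universe s)) ≤ N →
             Eval 10 ((encodeList encodeString W ∙ encodeString s) ∷ []) 0 (Program.main program)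
               (encodeList encodeString (SetCover.seeded separates s W (universe s) W))
  main-run {m} W s m≤N lenW lenU =
    case-cons var
      (lower
        (var ∷ lower (var ∷ nil ∷ var ∷ [])
                 (onePairs-run (toList s) 0 (toList s) (length≤N s) (length≤N s))
             ∷ var ∷ var ∷ [])
        (seeded-run s W (universe s) W lenW lenW lenU))
    where open Greedy m≤N

-- Greedy set cover

smaller-≤ : {A : Set} (size : A → ℕ) (x y : A) →
            size (smaller size x y) ≤ size x × size (smaller size x y) ≤ size y
smaller-≤ size x y with size x ≤ᵇ size y in eq
... | true  = ≤-refl , ≤ᵇ⇒≤ (size x) (size y) (subst T (sym eq) tt)
... | false = ≰⇒≥ (λ x≤y → subst T eq (≤⇒≤ᵇ x≤y)) , ≤-refl

smaller-elim : {A : Set} (P : A → Set) (size : A → ℕ) {x y : A} → P x → P y → P (smaller size x y)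
smaller-elim P size {x} {y} px py with size x ≤ᵇ size y
... | true  = px
... | false = py

module SetCoverProperties {X E : Set} (covers : X → E → Bool) where
  open SetCover covers

  Covers : List X → List E → Set
  Covers D R = ∀ {e} → e ∈ R → ∃[ w ] (w ∈ D × covers w e ≡ true)

  Covers-⊆ : ∀ {D W R} → D ⊆ W → Covers D R → Covers W R
  Covers-⊆ D⊆W cov e∈R with cov e∈R
  ... | w , w∈D , c = w , D⊆W w∈D , c

  ∈-residual⁻ : ∀ R w {e} → e ∈ residual R w → e ∈ R × covers w e ≡ false
  ∈-residual⁻ (f ∷ R) w e∈ with covers w f in eq
  ∈-residual⁻ (f ∷ R) w e∈         | true with ∈-residual⁻ R w e∈
  ... | e∈R , c = there e∈R , c
  ∈-residual⁻ (f ∷ R) w (here refl) | false = here refl , eq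
  ∈-residual⁻ (f ∷ R) w (there e∈) | false with ∈-residual⁻ R w e∈
  ... | e∈R , c = there e∈R , c

  ∈-residual⁺ : ∀ R w {e} → e ∈ R → covers w e ≡ false → e ∈ residual R w
  ∈-residual⁺ (f ∷ R) w (here refl) c rewrite c = here refl
  ∈-residual⁺ (f ∷ R) w (there e∈) c with covers w f
  ... | true  = ∈-residual⁺ R w e∈ c
  ... | false = there (∈-residual⁺ R w e∈ c)

  length-residual-< : ∀ R w {e} → e ∈ R → covers w e ≡ true → length (residual R w) < length R
  length-residual-< (f ∷ R) w (here refl) c rewrite c = s≤s (length-residual R w)
  length-residual-< (f ∷ R) w (there e∈) c with covers w f
  ... | true  = m<n⇒m<1+n (length-residual-< R w e∈ c)
  ... | false = s≤s (length-residual-< R w e∈ c)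

  length-residual-<⁻ : ∀ R w → length (residual R w) < length R → ∃[ e ] (e ∈ R × covers w e ≡ true)
  length-residual-<⁻ (e ∷ R) w lt with covers w e in eq
  ... | true  = e , here refl , eq
  ... | false with length-residual-<⁻ R w (≤-pred lt)
  ... | f , f∈ , c = f , there f∈ , c

  Covers-residual : ∀ {D} R w → Covers D R → Covers D (residual R w)
  Covers-residual R w cov e∈ = cov (proj₁ (∈-residual⁻ R w e∈))

  Covers-tail : ∀ {d D} R → Covers (d ∷ D) R → Covers D (residual R d)
  Covers-tail {d} R cov e∈ with ∈-residual⁻ R d e∈
  ... | e∈R , ¬c with cov e∈R
  ... | w , here refl , c with () ← trans (sym c) ¬c
  ... | w , there w∈D , c = w , w∈D , c

  Covers-[] : ∀ {R} → Covers [] R → R ≡ []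
  Covers-[] {[]}    cov = refl
  Covers-[] {e ∷ R} cov with cov (here refl)
  ... | _ , () , _

  -- What `w` covers of the rest left by `d` is part of what it covers of `R`: diminishing returns,
  -- written without subtraction.
  submodular : ∀ R d w → length (residual R w) + length (residual R d) ≤
                         length R + length (residual (residual R d) w)
  submodular []      d w = z≤n
  submodular (e ∷ R) d w with covers w e in eq | covers d e
  ... | true  | true  = m≤n⇒m≤1+n (submodular R d w)
  ... | false | true  = s≤s (submodular R d w)
  ... | true  | false rewrite eq | +-suc (length (residual R w)) (length (residual R d)) =
    s≤s (submodular R d w)
  ... | false | false rewrite eq | +-suc (length (residual R w)) (length (residual R d))
                                 | +-suc (length R) (length (residual (residual R d) w)) =
    s≤s (s≤s (submodular R d w))

  -- Of d and the w found in D for the rest, the one which leaves less will do.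
  averaging : ∀ {j} D R → length D ≡ suc j → Covers D R →
              ∃[ w ] (w ∈ D × suc j * length (residual R w) ≤ j * length R)
  averaging {zero} (d ∷ []) R _ cov =
    d , here refl , ≤-reflexive (cong (λ L → 1 * length L) (Covers-[] (Covers-tail R cov)))
  averaging {suc j} (d ∷ D) R len cov
    with averaging D (residual R d) (suc-injective len) (Covers-tail R cov)
  ... | w , w∈D , avg = choose (≤-total r x)
    where
    n = length R
    r = length (residual R d)
    x = length (residual R w)
    u = length (residual (residual R d) w)
    open ≤-Reasoning
    -- Submodularity carries the inductive bound on `u` back to `x`. The left side weights `r` once
    -- and `x` `suc j` times, so replacing both by the smaller of the two gives the claim.
    r+kx≤kn : r + suc j * x ≤ suc j * n
    r+kx≤kn = +-cancelʳ-≤ (j * r) _ _ (begin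
      r + suc j * x + j * r
        ≡⟨ solve 3 (λ r x j → r :+ (con 1 :+ j) :* x :+ j :* r := (con 1 :+ j) :* (x :+ r))
                 refl r x j ⟩
      suc j * (x + r)
        ≤⟨ *-monoʳ-≤ (suc j) (submodular R d w) ⟩
      suc j * (n + u)
        ≡⟨ *-distribˡ-+ (suc j) n u ⟩
      suc j * n + suc j * u
        ≤⟨ +-monoʳ-≤ (suc j * n) avg ⟩
      suc j * n + j * r ∎)
      where open +-*-Solver
    choose : r ≤ x ⊎ x ≤ r →
             ∃[ v ] (v ∈ d ∷ D × suc (suc j) * length (residual R v) ≤ suc j * n)
    choose (inj₁ r≤x) = d , here refl , ≤-trans (+-monoʳ-≤ r (*-monoʳ-≤ (suc j) r≤x)) r+kx≤kn
    choose (inj₂ x≤r) = w , there w∈D , ≤-trans (+-monoˡ-≤ (suc j * x) x≤r) r+kx≤kn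

  best-least : ∀ R d ws {w} → w ∈ ws → length (proj₂ (best R d ws)) ≤ length (residual R w)
  best-least R d (v ∷ ws) (here refl) =
    proj₁ (smaller-≤ (λ c → length (proj₂ c)) (v , residual R v) (best R d ws))
  best-least R d (v ∷ ws) (there w∈) =
    ≤-trans (proj₂ (smaller-≤ (λ c → length (proj₂ c)) (v , residual R v) (best R d ws)))
            (best-least R d ws w∈)

  best-source : ∀ R d ws → (∃[ w ] (w ∈ ws × best R d ws ≡ (w , residual R w))) ⊎ best R d ws ≡ (d , R)
  best-source R d []       = inj₂ refl
  best-source R d (w ∷ ws)
    with length (residual R w) ≤ᵇ length (proj₂ (best R d ws)) | best-source R d ws
  ... | true  | _                  = inj₁ (w , here refl , refl)
  ... | false | inj₁ (v , v∈ , eq) = inj₁ (v , there v∈ , eq)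
  ... | false | inj₂ eq            = inj₂ eq

  best-covered : ∀ {W e} R d → e ∈ R → Covers W R →
                 ∃[ w ] (w ∈ W × best R d W ≡ (w , residual R w) × length (residual R w) < length R)
  best-covered {W} R d e∈R cov with cov e∈R
  ... | v , v∈W , c with best-source R d W | best-least R d W v∈W | length-residual-< R v e∈R c
  ... | inj₁ (w , w∈W , eq) | least | lt rewrite eq = w , w∈W , refl , ≤-<-trans least lt
  ... | inj₂ eq             | least | lt rewrite eq = contradiction (≤-<-trans least lt) (<-irrefl refl)

  module Greedy (d : X) (W : List X) where

    -- The properties of the list C chosen for covering R; the last one implies
    -- that a string chosen before, which covers nothing of R, is not repeated.
    record Selection (R : List E) (C : List X) : Set where
      field
        unique   : Unique C
        included : C ⊆ W
        covering : Covers C R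
        useful   : ∀ {x} → x ∈ C → ∃[ e ] (e ∈ R × covers x e ≡ true)

    Sound : List E → List X → Set
    Sound R C = Unique C × C ⊆ W × Covers C R

    sound : ∀ {R C} → Selection R C → Sound R C
    sound S = unique , included , covering where open Selection S

    extend : ∀ {w} R {C} → w ∈ W → Selection (residual R w) C → Sound R (w ∷ C)
    extend {w} R {C} w∈W S = All.tabulate fresh ∷ unique , ⊆W , cov
      where
      open Selection S
      fresh : ∀ {x} → x ∈ C → w ≢ x
      fresh x∈C refl with useful x∈C
      ... | e , e∈ , c with () ← trans (sym c) (proj₂ (∈-residual⁻ R w e∈))
      ⊆W : w ∷ C ⊆ W
      ⊆W (here refl) = w∈W
      ⊆W (there x∈C) = included x∈C
      cov : Covers (w ∷ C) R
      cov {e} e∈R with covers w e in eq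
      ... | true  = w , here refl , eq
      ... | false with covering (∈-residual⁺ R w e∈R eq)
      ... | x , x∈C , c = x , there x∈C , c

    greedy-selection : ∀ n R → length R ≤ n → Covers W R → Selection R (greedy d W n R)
    greedy-selection zero [] _ _ =
      record { unique = [] ; included = λ () ; covering = λ () ; useful = λ () }
    greedy-selection (suc n) [] _ _ =
      record { unique = [] ; included = λ () ; covering = λ () ; useful = λ () }
    greedy-selection (suc n) R@(_ ∷ _) len cov with best R d W | best-covered R d (here refl) cov
    ... | _ | w , w∈W , refl , lt =
      record { unique = proj₁ S ; included = proj₁ (proj₂ S) ; covering = proj₂ (proj₂ S) ; useful = use }
      where
      rest = greedy-selection n (residual R w) (≤-pred (≤-trans lt len)) (Covers-residual R w cov)
      S = extend R w∈W rest
      use : ∀ {x} → x ∈ w ∷ greedy d W n (residual R w) → ∃[ e ] (e ∈ R × covers x e ≡ true)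
      use (there x∈) with Selection.useful rest x∈
      ... | e , e∈ , c = e , proj₁ (∈-residual⁻ R w e∈) , c
      use (here refl) = length-residual-<⁻ R w lt

    length-greedy-≤ : ∀ n R → Covers W R → length (greedy d W n R) ≤ length R
    length-greedy-≤ zero    R  _ = z≤n
    length-greedy-≤ (suc n) [] _ = z≤n
    length-greedy-≤ (suc n) R@(_ ∷ _) cov with best R d W | best-covered R d (here refl) cov
    ... | _ | w , w∈W , refl , lt =
      ≤-trans (s≤s (length-greedy-≤ n (residual R w) (Covers-residual R w cov))) lt

    -- The least residual is empty here, so the first choice already finishes. This is what makes a
    -- seeded run optimal for an optimum of two.
    greedy-singleton : ∀ n {v} R → v ∈ W → Covers (v ∷ []) R → length (greedy d W n R) ≤ 1
    greedy-singleton zero    R  _ _ = z≤n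
    greedy-singleton (suc n) [] _ _ = z≤n
    greedy-singleton (suc n) {v} R@(_ ∷ _) v∈W cov with best R d W | best-least R d W v∈W
    ... | w , R′ | least rewrite Covers-[] (Covers-tail R cov) with n | R′ | least
    ... | zero  | []    | _ = ≤-refl
    ... | suc _ | []    | _ = ≤-refl

    -- t counts the choices after which at least suc j pairs are left; each
    -- of them leaves at most the fraction j / suc j of the pairs.
    Bounded : ℕ → ℕ → ℕ → Set
    Bounded j c N = ∃[ t ] (c ≤ t + suc j × suc j ^ suc t ≤ N * j ^ t)

    mutual
      greedy-bounded : ∀ {j} n D R → D ⊆ W → length D ≡ suc j → Covers D R →
                       suc j ≤ length R → length R ≤ n → Bounded j (length (greedy d W n R)) (length R)
      greedy-bounded {j} (suc n) D R@(_ ∷ _) D⊆W lenD cov large len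
        with best R d W | best-covered R d (here refl) (Covers-⊆ D⊆W cov)
           | best-least R d W | averaging D R lenD cov
      ... | _ | w , w∈W , refl , lt | least | v , v∈D , avg =
        step-bounded n D R w D⊆W lenD cov large (≤-pred (≤-trans lt len))
          (≤-trans (*-monoʳ-≤ (suc j) (least (D⊆W v∈D))) avg)

      -- The choice `w` is required only to shrink `R` enough, so that the lemma applies to greedy
      -- choices and to seeds alike.
      step-bounded : ∀ {j} n D R w → D ⊆ W → length D ≡ suc j → Covers D R →
                     suc j ≤ length R → length (residual R w) ≤ n →
                     suc j * length (residual R w) ≤ j * length R →
                     Bounded j (suc (length (greedy d W n (residual R w)))) (length R)
      step-bounded {j} n D R w D⊆W lenD cov large len shrink with suc j ≤? length (residual R w)
      -- At most `j` pairs are left and each further choice covers one of them, so together with `w`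
      -- there are at most `suc j` choices.
      ... | no small = 0 ,
        ≤-trans (s≤s (length-greedy-≤ n (residual R w) (Covers-⊆ D⊆W (Covers-residual R w cov)))) (≰⇒> small) ,
        (begin
          suc j * 1      ≡⟨ *-identityʳ (suc j) ⟩
          suc j          ≤⟨ large ⟩
          length R       ≡⟨ *-identityʳ (length R) ⟨
          length R * 1   ∎)
        where open ≤-Reasoning
      ... | yes large′ with greedy-bounded n D (residual R w) D⊆W lenD (Covers-residual R w cov) large′ len
      ... | t , c≤ , pow = suc t , s≤s c≤ , (begin
          suc j * suc j ^ suc t                      ≤⟨ *-monoʳ-≤ (suc j) pow ⟩
          suc j * (length (residual R w) * j ^ t)    ≡⟨ *-assoc (suc j) (length (residual R w)) (j ^ t) ⟨
          suc j * length (residual R w) * j ^ t      ≤⟨ *-monoˡ-≤ (j ^ t) shrink ⟩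
          j * length R * j ^ t                       ≡⟨ cong (_* j ^ t) (*-comm j (length R)) ⟩
          length R * j * j ^ t                       ≡⟨ *-assoc (length R) j (j ^ t) ⟩
          length R * (j * j ^ t)                     ∎)
        where open ≤-Reasoning

    module Seeded (U : List E) (cov : Covers W U) where

      seed : X → List X
      seed w = w ∷ greedy d W (length U) (residual U w)

      seeded-sound : ∀ ws → ws ⊆ W → Sound U (seeded d W U ws)
      seeded-sound []       _    = sound (greedy-selection (length U) U ≤-refl cov)
      seeded-sound (w ∷ ws) ws⊆W =
        smaller-elim (Sound U) length {seed w}
          (extend U (ws⊆W (here refl))
            (greedy-selection (length U) (residual U w) (length-residual U w) (Covers-residual U w cov)))
          (seeded-sound ws (λ v∈ → ws⊆W (there v∈)))

      length-seeded : ∀ ws {w} → w ∈ ws → length (seeded d W U ws) ≤ length (seed w)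
      length-seeded (v ∷ ws) (here refl) = proj₁ (smaller-≤ length (seed v) (seeded d W U ws))
      length-seeded (v ∷ ws) (there w∈)  =
        ≤-trans (proj₂ (smaller-≤ length (seed v) (seeded d W U ws))) (length-seeded ws w∈)

      -- A seed covering `e` takes care of at least one pair, and so does every later choice.
      length-seeded-≤ : ∀ {e} → e ∈ U → length (seeded d W U W) ≤ length U
      length-seeded-≤ e∈U with cov e∈U
      ... | w , w∈W , c =
        ≤-trans (length-seeded W w∈W)
          (≤-trans (s≤s (length-greedy-≤ (length U) (residual U w) (Covers-residual U w cov)))
                   (length-residual-< U w e∈U c))

      -- Seeding does not spoil the greedy estimate: the string found by `averaging` is among the
      -- seeds tried, and it shrinks `U` as much as a greedy choice is required to.
      seeded-bounded : ∀ {j} D → D ⊆ W → length D ≡ suc j → Covers D U → suc j ≤ length U →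
                       Bounded j (length (seeded d W U W)) (length U)
      seeded-bounded D D⊆W lenD covD large with averaging D U lenD covD
      ... | w , w∈D , shrink
        with step-bounded (length U) D U w D⊆W lenD covD large (length-residual U w) shrink
      ... | t , c≤ , pow = t , ≤-trans (length-seeded W (D⊆W w∈D)) c≤ , pow

      seeded-optimal : ∀ D → D ⊆ W → Covers D U → length D ≤ 2 → 1 ≤ length D →
                       length (seeded d W U W) ≤ length D
      seeded-optimal (v ∷ []) D⊆W covD _ _ =
        ≤-trans (length-seeded W (D⊆W (here refl))) (s≤s (≤-trans
          (length-greedy-≤ (length U) (residual U v) (Covers-residual U v cov))
          (≤-reflexive (cong length (Covers-[] (Covers-tail U covD))))))
      seeded-optimal (v ∷ v′ ∷ []) D⊆W covD _ _ =
        ≤-trans (length-seeded W (D⊆W (here refl)))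
          (s≤s (greedy-singleton (length U) (residual U v) (D⊆W (there (here refl))) (Covers-tail U covD)))
      seeded-optimal (_ ∷ _ ∷ _ ∷ _) _ _ (s≤s (s≤s ())) _

-- The pairs to be separated

-- The two sides differ by the square of `b ∸ a`; writing `b` as `a + d` makes this a polynomial
-- identity.
a≤b⇒4ab≤[a+b]² : ∀ {a b} → a ≤ b → 4 * (a * b) ≤ (a + b) * (a + b)
a≤b⇒4ab≤[a+b]² {a} {b} a≤b = subst (λ b → 4 * (a * b) ≤ (a + b) * (a + b)) (m+[n∸m]≡n a≤b) (begin
  4 * (a * (a + d))
    ≤⟨ m≤m+n _ (d * d) ⟩
  4 * (a * (a + d)) + d * d
    ≡⟨ solve 2 (λ a d → con 4 :* (a :* (a :+ d)) :+ d :* d :=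
                        (a :+ (a :+ d)) :* (a :+ (a :+ d))) refl a d ⟩
  (a + (a + d)) * (a + (a + d)) ∎)
  where
  open ≤-Reasoning
  open +-*-Solver
  d = b ∸ a

4ab≤[a+b]² : ∀ a b → 4 * (a * b) ≤ (a + b) * (a + b)
4ab≤[a+b]² a b with ≤-total a b
... | inj₁ a≤b = a≤b⇒4ab≤[a+b]² a≤b
... | inj₂ b≤a rewrite *-comm a b | +-comm a b = a≤b⇒4ab≤[a+b]² b≤a

ones zeros : List Bool → ℕ
ones []           = 0
ones (true ∷ t)   = suc (ones t)
ones (false ∷ t)  = ones t
zeros []          = 0
zeros (true ∷ t)  = zeros t
zeros (false ∷ t) = suc (zeros t)

ones+zeros : ∀ t → ones t + zeros t ≡ length t
ones+zeros []          = refl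
ones+zeros (true ∷ t)  = cong suc (ones+zeros t)
ones+zeros (false ∷ t) = trans (+-suc (ones t) (zeros t)) (cong suc (ones+zeros t))

length-zeroPairs : ∀ t j i acc → length (zeroPairs t j i acc) ≡ zeros t + length acc
length-zeroPairs []          j i acc = refl
length-zeroPairs (false ∷ t) j i acc = cong suc (length-zeroPairs t (suc j) i acc)
length-zeroPairs (true ∷ t)  j i acc = length-zeroPairs t (suc j) i acc

length-onePairs : ∀ t i s → length (onePairs t i s) ≡ ones t * zeros s
length-onePairs []          i s = refl
length-onePairs (false ∷ t) i s = length-onePairs t (suc i) s
length-onePairs (true ∷ t)  i s =
  trans (length-zeroPairs s 0 i (onePairs t (suc i) s)) (cong (_+_ (zeros s)) (length-onePairs t (suc i) s))

length-universe : ∀ {m} (s : BitString m) → 4 * length (universe s) ≤ m * m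
length-universe {m} s = begin
  4 * length (universe s)                   ≡⟨ cong (4 *_) (length-onePairs b 0 b) ⟩
  4 * (ones b * zeros b)                    ≤⟨ 4ab≤[a+b]² (ones b) (zeros b) ⟩
  (ones b + zeros b) * (ones b + zeros b)   ≡⟨ cong (λ n → n * n) (trans (ones+zeros b) (length-toList s)) ⟩
  m * m                                     ∎
  where
  open ≤-Reasoning
  b = toList s

∈-zeroPairs⁻ : ∀ t j i acc {e} → e ∈ zeroPairs t j i acc →
               (∃[ j′ ] (e ≡ (i , j + j′) × nth t j′ ≡ false)) ⊎ e ∈ acc
∈-zeroPairs⁻ []          j i acc e∈ = inj₂ e∈
∈-zeroPairs⁻ (false ∷ t) j i acc (here refl) = inj₁ (0 , cong (i ,_) (sym (+-identityʳ j)) , refl)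
∈-zeroPairs⁻ (false ∷ t) j i acc (there e∈) with ∈-zeroPairs⁻ t (suc j) i acc e∈
... | inj₁ (j′ , refl , z) = inj₁ (suc j′ , cong (i ,_) (sym (+-suc j j′)) , z)
... | inj₂ e∈acc = inj₂ e∈acc
∈-zeroPairs⁻ (true ∷ t)  j i acc e∈ with ∈-zeroPairs⁻ t (suc j) i acc e∈
... | inj₁ (j′ , refl , z) = inj₁ (suc j′ , cong (i ,_) (sym (+-suc j j′)) , z)
... | inj₂ e∈acc = inj₂ e∈acc

∈-onePairs⁻ : ∀ t i s {e} → e ∈ onePairs t i s →
              ∃[ i′ ] ∃[ j ] (e ≡ (i + i′ , j) × nth t i′ ≡ true × nth s j ≡ false)
∈-onePairs⁻ (false ∷ t) i s e∈ with ∈-onePairs⁻ t (suc i) s e∈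
... | i′ , j , refl , o , z = suc i′ , j , cong (_, j) (sym (+-suc i i′)) , o , z
∈-onePairs⁻ (true ∷ t)  i s e∈ with ∈-zeroPairs⁻ s 0 i (onePairs t (suc i) s) e∈
... | inj₁ (j , refl , z) = 0 , j , cong (_, j) (sym (+-identityʳ i)) , refl , z
... | inj₂ e∈′ with ∈-onePairs⁻ t (suc i) s e∈′
... | i′ , j , refl , o , z = suc i′ , j , cong (_, j) (sym (+-suc i i′)) , o , z

∈-zeroPairs-acc : ∀ t j i acc {e} → e ∈ acc → e ∈ zeroPairs t j i acc
∈-zeroPairs-acc []          j i acc e∈ = e∈
∈-zeroPairs-acc (false ∷ t) j i acc e∈ = there (∈-zeroPairs-acc t (suc j) i acc e∈)
∈-zeroPairs-acc (true ∷ t)  j i acc e∈ = ∈-zeroPairs-acc t (suc j) i acc e∈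

∈-zeroPairs⁺ : ∀ t j i acc {j′} → j′ < length t → nth t j′ ≡ false → (i , j + j′) ∈ zeroPairs t j i acc
∈-zeroPairs⁺ (false ∷ t) j i acc {zero}   _ _ = here (cong (i ,_) (+-identityʳ j))
∈-zeroPairs⁺ (false ∷ t) j i acc {suc j′} (s≤s lt) z rewrite +-suc j j′ =
  there (∈-zeroPairs⁺ t (suc j) i acc lt z)
∈-zeroPairs⁺ (true ∷ t)  j i acc {suc j′} (s≤s lt) z rewrite +-suc j j′ = ∈-zeroPairs⁺ t (suc j) i acc lt z

∈-onePairs⁺ : ∀ t i s {i′ j} → nth t i′ ≡ true → j < length s → nth s j ≡ false →
              (i + i′ , j) ∈ onePairs t i s
∈-onePairs⁺ (false ∷ t) i s {suc i′} o lt z rewrite +-suc i i′ = ∈-onePairs⁺ t (suc i) s o lt z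
∈-onePairs⁺ (true ∷ t)  i s {zero} o lt z rewrite +-identityʳ i = ∈-zeroPairs⁺ s 0 i _ lt z
∈-onePairs⁺ (true ∷ t)  i s {suc i′} o lt z rewrite +-suc i i′ =
  ∈-zeroPairs-acc s 0 i _ (∈-onePairs⁺ t (suc i) s o lt z)

∈-universe⁻ : ∀ {m} (s : BitString m) {i j} → (i , j) ∈ universe s →
              nth (toList s) i ≡ true × nth (toList s) j ≡ false
∈-universe⁻ s e∈ with ∈-onePairs⁻ (toList s) 0 (toList s) e∈
... | _ , _ , refl , o , z = o , z

-- Only `j` needs a bound: positions beyond the end also read as 0, whereas a position carrying 1
-- lies inside the string.
∈-universe⁺ : ∀ {m} (s : BitString m) {i j} → nth (toList s) i ≡ true → j < m →
              nth (toList s) j ≡ false → (i , j) ∈ universe s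
∈-universe⁺ s o j<m z =
  ∈-onePairs⁺ (toList s) 0 (toList s) o (subst (_ <_) (sym (length-toList s)) j<m) z

-- Representability

-- The condition on `f` takes care of the positions beyond the end.
nth-zipWith : ∀ (f : Bool → Bool → Bool) → f false false ≡ false → ∀ {m} (x y : BitString m) i →
              nth (toList (zipWith f x y)) i ≡ f (nth (toList x) i) (nth (toList y) i)
nth-zipWith f f₀ []      []      i       = sym f₀
nth-zipWith f f₀ (a ∷ x) (b ∷ y) zero    = refl
nth-zipWith f f₀ (a ∷ x) (b ∷ y) (suc i) = nth-zipWith f f₀ x y i

nth-injective : ∀ {m} (x y : BitString m) → (∀ i → i < m → nth (toList x) i ≡ nth (toList y) i) → x ≡ y
nth-injective []      []      eq = refl
nth-injective (a ∷ x) (b ∷ y) eq =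
  cong₂ _∷_ (eq 0 z<s) (nth-injective x y λ i i<m → eq (suc i) (s<s i<m))

∃-one : ∀ {m} (s : BitString m) → s ≢ 𝟎 m → ∃[ i ] nth (toList s) i ≡ true
∃-one []          s≢𝟎 = contradiction refl s≢𝟎
∃-one (true ∷ s)  s≢𝟎 = 0 , refl
∃-one (false ∷ s) s≢𝟎 with ∃-one s (λ s≡𝟎 → s≢𝟎 (cong (false ∷_) s≡𝟎))
... | i , o = suc i , o

∃-zero : ∀ {m} (s : BitString m) → s ≢ 𝟏 m → ∃[ j ] (j < m × nth (toList s) j ≡ false)
∃-zero []          s≢𝟏 = contradiction refl s≢𝟏
∃-zero (false ∷ s) s≢𝟏 = 0 , z<s , refl
∃-zero (true ∷ s)  s≢𝟏 with ∃-zero s (λ s≡𝟏 → s≢𝟏 (cong (true ∷_) s≡𝟏))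
... | j , j<m , z = suc j , s<s j<m , z

∧-true⁻ : ∀ {a b} → a ∧ b ≡ true → a ≡ true × b ≡ true
∧-true⁻ {true} {true} refl = refl , refl

∧-false⁻ : ∀ {a b} → a ∧ b ≡ false → a ≡ false ⊎ b ≡ false
∧-false⁻ {false} _  = inj₁ refl
∧-false⁻ {true}  eq = inj₂ eq

∨-true⁻ : ∀ {a b} → a ∨ b ≡ true → a ≡ true ⊎ b ≡ true
∨-true⁻ {true}  _  = inj₁ refl
∨-true⁻ {false} eq = inj₂ eq

∨-false⁻ : ∀ {a b} → a ∨ b ≡ false → a ≡ false × b ≡ false
∨-false⁻ {false} {false} refl = refl , refl

separates⁺ : ∀ {m} (x : BitString m) {i j} → nth (toList x) i ≡ true → nth (toList x) j ≡ false →
             separates x (i , j) ≡ true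
separates⁺ x o z rewrite o | z = refl

separates⁻ : ∀ {m} (x : BitString m) {i j} → separates x (i , j) ≡ true →
             nth (toList x) i ≡ true × nth (toList x) j ≡ false
separates⁻ x {i} {j} sep with nth (toList x) i | nth (toList x) j
... | true | false = refl , refl

module Representations {m : ℕ} (C : List (BitString m)) where
  open SetCoverProperties (separates {m}) using (Covers)

  bit : Formula C → ℕ → Bool
  bit φ i = nth (toList (eval φ)) i

  bit-∧ : ∀ φ ψ i → bit (φ ⟨∧⟩ ψ) i ≡ bit φ i ∧ bit ψ i
  bit-∧ φ ψ = nth-zipWith _∧_ refl (eval φ) (eval ψ)

  bit-∨ : ∀ φ ψ i → bit (φ ⟨∨⟩ ψ) i ≡ bit φ i ∨ bit ψ i
  bit-∨ φ ψ = nth-zipWith _∨_ refl (eval φ) (eval ψ)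

  -- Separation passes down to a subformula: at a conjunction both parts are 1 at `i` and one of
  -- them is 0 at `j`, and dually at a disjunction. This uses the absence of negation.
  separating-operand : ∀ φ {i j} → bit φ i ≡ true → bit φ j ≡ false →
                       ∃[ x ] (x ∈ C × separates x (i , j) ≡ true)
  separating-operand (operand x x∈C) o z = x , x∈C , separates⁺ x o z
  separating-operand (φ ⟨∧⟩ ψ) {i} {j} o z
    with ∧-true⁻ (trans (sym (bit-∧ φ ψ i)) o) | ∧-false⁻ (trans (sym (bit-∧ φ ψ j)) z)
  ... | oφ , oψ | inj₁ zφ = separating-operand φ oφ zφ
  ... | oφ , oψ | inj₂ zψ = separating-operand ψ oψ zψ
  separating-operand (φ ⟨∨⟩ ψ) {i} {j} o z
    with ∨-true⁻ (trans (sym (bit-∨ φ ψ i)) o) | ∨-false⁻ (trans (sym (bit-∨ φ ψ j)) z)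
  ... | inj₁ oφ | zφ , zψ = separating-operand φ oφ zφ
  ... | inj₂ oψ | zφ , zψ = separating-operand ψ oψ zψ

  representable⇒covers : ∀ {s} → Representable C s → Covers C (universe s)
  representable⇒covers (φ , refl) e∈ with ∈-universe⁻ (eval φ) e∈
  ... | o , z = separating-operand φ o z

  module _ (s : BitString m) (s≢𝟎 : s ≢ 𝟎 m) (s≢𝟏 : s ≢ 𝟏 m) (cov : Covers C (universe s)) where

    sbit : ℕ → Bool
    sbit i = nth (toList s) i

    separator : ∀ {i j} → sbit i ≡ true → j < m → sbit j ≡ false →
                ∃[ φ ] (bit φ i ≡ true × bit φ j ≡ false)
    separator o j<m z with cov (∈-universe⁺ s o j<m z)
    ... | x , x∈C , sep = operand x x∈C , separates⁻ x sep

    -- A term of the disjunctive normal form of `s`. There is no constant formula for the empty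
    -- conjunction, so a separator from some zero position, supplied by `s≢𝟏`, starts it.
    conjunction : ∀ {i} → sbit i ≡ true → ∀ n → n ≤ m →
                  ∃[ φ ] (bit φ i ≡ true × (∀ j → j < n → sbit j ≡ false → bit φ j ≡ false))
    conjunction o zero n≤m with ∃-zero s s≢𝟏
    ... | j , j<m , z with separator o j<m z
    ... | φ , oφ , _ = φ , oφ , λ _ ()
    conjunction {i} o (suc n) n<m with conjunction o n (<⇒≤ n<m) | sbit n in sₙ
    ... | φ , oφ , zφ | true = φ , oφ , zeroes
      where
      zeroes : ∀ j → j < suc n → sbit j ≡ false → bit φ j ≡ false
      zeroes j j<1+n z with m≤n⇒m<n∨m≡n (≤-pred j<1+n)
      ... | inj₁ j<n  = zφ j j<n z
      ... | inj₂ refl with () ← trans (sym z) sₙ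
    ... | φ , oφ , zφ | false with separator o n<m sₙ
    ... | ψ , oψ , zψ = φ ⟨∧⟩ ψ , trans (bit-∧ φ ψ i) (cong₂ _∧_ oφ oψ) , zeroes
      where
      zeroes : ∀ j → j < suc n → sbit j ≡ false → bit (φ ⟨∧⟩ ψ) j ≡ false
      zeroes j j<1+n z with m≤n⇒m<n∨m≡n (≤-pred j<1+n)
      ... | inj₁ j<n  = trans (bit-∧ φ ψ j) (cong (_∧ bit ψ j) (zφ j j<n z))
      ... | inj₂ refl = trans (bit-∧ φ ψ j) (trans (cong (bit φ j ∧_) zψ) (∧-zeroʳ (bit φ j)))

    -- For want of an empty disjunction, the term of some one position, supplied by `s≢𝟎`, comes
    -- first. It vanishes at every zero position, so it does no harm.
    disjunction : ∀ n → ∃[ φ ] ((∀ j → j < m → sbit j ≡ false → bit φ j ≡ false) ×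
                                (∀ i → i < n → sbit i ≡ true → bit φ i ≡ true))
    disjunction zero with ∃-one s s≢𝟎
    ... | i , o with conjunction o m ≤-refl
    ... | φ , _ , zφ = φ , zφ , λ _ ()
    disjunction (suc n) with disjunction n | sbit n in sₙ
    ... | φ , zφ , oφ | false = φ , zφ , hits
      where
      hits : ∀ i → i < suc n → sbit i ≡ true → bit φ i ≡ true
      hits i i<1+n o with m≤n⇒m<n∨m≡n (≤-pred i<1+n)
      ... | inj₁ i<n  = oφ i i<n o
      ... | inj₂ refl with () ← trans (sym o) sₙ
    ... | φ , zφ , oφ | true with conjunction sₙ m ≤-refl
    ... | ψ , oψ , zψ = φ ⟨∨⟩ ψ , misses , hits
      where
      misses : ∀ j → j < m → sbit j ≡ false → bit (φ ⟨∨⟩ ψ) j ≡ false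
      misses j j<m z = trans (bit-∨ φ ψ j) (cong₂ _∨_ (zφ j j<m z) (zψ j j<m z))
      hits : ∀ i → i < suc n → sbit i ≡ true → bit (φ ⟨∨⟩ ψ) i ≡ true
      hits i i<1+n o with m≤n⇒m<n∨m≡n (≤-pred i<1+n)
      ... | inj₁ i<n  = trans (bit-∨ φ ψ i) (cong (_∨ bit ψ i) (oφ i i<n o))
      ... | inj₂ refl = trans (bit-∨ φ ψ i) (trans (cong (bit φ i ∨_) oψ) (∨-zeroʳ (bit φ i)))

    covers⇒representable : Representable C s
    covers⇒representable with disjunction m
    ... | φ , zφ , oφ = φ , nth-injective (eval φ) s agree
      where
      agree : ∀ i → i < m → bit φ i ≡ sbit i
      agree i i<m with sbit i in sᵢ
      ... | true  = oφ i i<m sᵢ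
      ... | false = zφ i i<m sᵢ

-- The approximation ratio

square-cancel-≤ : ∀ {x y} → x * x ≤ y * y → x ≤ y
square-cancel-≤ xx≤yy = ≮⇒≥ λ y<x → <⇒≱ (*-mono-< y<x y<x) xx≤yy

-- The square of the claim is a consequence of 4 (j + 1) j ≤ (2 j + 1)².
power-estimate : ∀ {a b} j t N m → a * a ≤ 3 * (b * b) → 2 ≤ j →
                 suc j ^ suc t ≤ N * j ^ t → 4 * N ≤ m * m →
                 2 * ((2 * suc j) ^ t * a) ≤ suc (2 * j) ^ t * b * m
power-estimate {a} {b} j t N m a²≤3b² 2≤j pow 4N≤m² = square-cancel-≤ (begin
  2 * (q ^ t * a) * (2 * (q ^ t * a))
    ≡⟨ solve 2 (λ x a → con 2 :* (x :* a) :* (con 2 :* (x :* a)) := con 4 :* ((x :* x) :* (a :* a)))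
             refl (q ^ t) a ⟩
  4 * (q ^ t * q ^ t * (a * a))
    ≤⟨ *-monoʳ-≤ 4 (*-mono-≤ (≤-reflexive q²ᵗ) a²≤3b²) ⟩
  4 * (r ^ t * k ^ t * (3 * (b * b)))
    ≡⟨ solve 3 (λ x y b → con 4 :* (x :* y :* (con 3 :* (b :* b))) :=
                          con 4 :* (b :* b :* (x :* (con 3 :* y))))
             refl (r ^ t) (k ^ t) b ⟩
  4 * (b * b * (r ^ t * (3 * k ^ t)))
    -- Here `3 ≤ k` enters: the constant that bounds the square of `a / b` becomes the surplus
    -- factor `k` of the greedy estimate.
    ≤⟨ *-monoʳ-≤ 4 (*-monoʳ-≤ (b * b) (*-monoʳ-≤ (r ^ t) (*-monoˡ-≤ (k ^ t) (s≤s 2≤j)))) ⟩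
  4 * (b * b * (r ^ t * k ^ suc t))
    ≤⟨ *-monoʳ-≤ 4 (*-monoʳ-≤ (b * b) (*-monoʳ-≤ (r ^ t) pow)) ⟩
  4 * (b * b * (r ^ t * (N * j ^ t)))
    ≡⟨ solve 4 (λ x n y b → con 4 :* (b :* b :* (x :* (n :* y))) :=
                            b :* b :* (x :* y) :* (con 4 :* n))
             refl (r ^ t) N (j ^ t) b ⟩
  b * b * (r ^ t * j ^ t) * (4 * N)
    ≤⟨ *-mono-≤ (*-monoʳ-≤ (b * b) p²ᵗ) 4N≤m² ⟩
  b * b * (p ^ t * p ^ t) * (m * m)
    ≡⟨ solve 3 (λ x m b → b :* b :* (x :* x) :* (m :* m) := x :* b :* m :* (x :* b :* m))
             refl (p ^ t) m b ⟩
  p ^ t * b * m * (p ^ t * b * m) ∎)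
  where
  open ≤-Reasoning
  open +-*-Solver
  k = suc j
  q = 2 * k
  p = suc (2 * j)
  r = 4 * k
  q²ᵗ : q ^ t * q ^ t ≡ r ^ t * k ^ t
  q²ᵗ = begin-equality
    q ^ t * q ^ t  ≡⟨ ^-distrib-* q q t ⟨
    (q * q) ^ t    ≡⟨ cong (_^ t) (solve 1 (λ k → con 2 :* k :* (con 2 :* k) := con 4 :* k :* k) refl k) ⟩
    (r * k) ^ t    ≡⟨ ^-distrib-* r k t ⟩
    r ^ t * k ^ t  ∎
  rj≤p² : r * j ≤ p * p
  rj≤p² = ≤-trans (n≤1+n (r * j)) (≤-reflexive
    (solve 1 (λ j → con 1 :+ con 4 :* (con 1 :+ j) :* j := (con 1 :+ con 2 :* j) :* (con 1 :+ con 2 :* j))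
           refl j))
  p²ᵗ : r ^ t * j ^ t ≤ p ^ t * p ^ t
  p²ᵗ = begin
    r ^ t * j ^ t  ≡⟨ ^-distrib-* r j t ⟨
    (r * j) ^ t    ≤⟨ ^-monoˡ-≤ t rj≤p² ⟩
    (p * p) ^ t    ≡⟨ ^-distrib-* p p t ⟩
    p ^ t * p ^ t  ∎

open Representations

module Solution (I : Instance) where
  open Instance I
  open SetCover (separates {m}) public
  open SetCoverProperties (separates {m}) public

  U : List Pair
  U = universe s

  covered : Covers W U
  covered = representable⇒covers W representable

  open Greedy s W public
  open Seeded U covered public

  ∃-pair : ∃[ e ] e ∈ U
  ∃-pair with ∃-one s s≢𝟎 | ∃-zero s s≢𝟏
  ... | i , o | j , j<m , z = (i , j) , ∈-universe⁺ s o j<m z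

algorithm : (I : Instance) → RepresentationSubset I
algorithm I = record
  { C             = seeded s W U W
  ; C-unique      = proj₁ sound′
  ; C⊆W           = proj₁ (proj₂ sound′)
  ; representable = covers⇒representable (seeded s W U W) s s≢𝟎 s≢𝟏 (proj₂ (proj₂ sound′))
  }
  where
  open Instance I
  open Solution I
  sound′ = seeded-sound W (λ w∈ → w∈)

approximation : (I : Instance) → 4 ≤ Instance.m I → (opt : ℕ) → IsMinimumCardinality I opt →
                ∣ algorithm I ∣ ≤ 2 * opt ·ln (+ Instance.m I / 2)
approximation I 4≤m _ ((R , refl) , minimal) =
  ratio C C⊆W (representable⇒covers C representable) (minimal (algorithm I))
  where
  open RepresentationSubset R
  open Instance I using (m; W; s)
  open Solution I

  c : ℕ
  c = ∣ algorithm I ∣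

  -- With `t = 0` the logarithm only has to reach 1 / 2, for which `(6 / 5)³ ≤ m / 2` is enough;
  -- cleared of denominators this is `432 ≤ 125 * m`, and `4 ≤ m` yields 500.
  few : ∀ j → c ≤ suc j → c ≤ 2 * suc j ·ln (+ m / 2)
  few j c≤ = ≤-·ln-half c (suc j) 0 m (suc (2 * j)) (sym (*-suc 2 j)) c≤
    (≤-trans (≤ᵇ⇒≤ 432 500 _) (*-monoʳ-≤ 125 4≤m)) (s≤s z≤n)

  -- The reason for steps of 1 / 6: six of them bound e by `(6 / 5)⁶`, just below 3, while steps of
  -- 1 / 4 would give `(4 / 3)⁴`, which exceeds 3.
  6⁶≤3*5⁶ : 6 ^ 3 * 6 ^ 3 ≤ 3 * (5 ^ 3 * 5 ^ 3)
  6⁶≤3*5⁶ = ≤ᵇ⇒≤ (6 ^ 3 * 6 ^ 3) (3 * (5 ^ 3 * 5 ^ 3)) _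

  many : ∀ j → 2 ≤ j → Bounded j c (length U) → c ≤ 2 * suc j ·ln (+ m / 2)
  many j 2≤j (t , c≤ , pow) =
    ≤-·ln-half c (suc j) t m (suc (2 * j)) (sym (*-suc 2 j)) c≤
      (power-estimate {6 ^ 3} {5 ^ 3} j t (length U) m 6⁶≤3*5⁶ 2≤j pow (length-universe s))
      (m^n>0 (suc (2 * j)) t)

  ratio : ∀ D → D ⊆ W → Covers D U → length D ≤ c → c ≤ 2 * length D ·ln (+ m / 2)
  ratio [] _ cov _ with cov (proj₂ ∃-pair)
  ... | _ , () , _
  ratio D@(_ ∷ []) D⊆W cov _ = few 0 (seeded-optimal D D⊆W cov (s≤s z≤n) ≤-refl)
  ratio D@(_ ∷ _ ∷ []) D⊆W cov _ = few 1 (seeded-optimal D D⊆W cov ≤-refl (s≤s z≤n))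
  ratio D@(_ ∷ D′@(_ ∷ _ ∷ _)) D⊆W cov D≤c =
    many (length D′) (s≤s (s≤s z≤n))
      -- By minimality the optimum is at most the size of the result, hence at most the number of
      -- pairs, as the count of stages presupposes.
      (seeded-bounded D D⊆W refl cov (≤-trans D≤c (length-seeded-≤ (proj₂ ∃-pair))))

-- Polynomial running time on instances

length≤size : {A : Set} (enc : A → Tree) (xs : List A) → length xs ≤ size (encodeList enc xs)
length≤size enc []       = z≤n
length≤size enc (x ∷ xs) = s≤s (≤-trans (length≤size enc xs) (m≤n+m _ _))

1≤size : ∀ t → 1 ≤ size t
1≤size nil     = ≤-refl
1≤size (l ∙ r) = s≤s z≤n

module Running (I : Instance) where
  open Instance I

  S N : ℕ
  S = size (encodeInstance I)
  -- The recursions run along bits, strings and pairs; the pairs, at most a quarter of `m * m`, make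
  -- the depth quadratic, and the successor serves the comparisons.
  N = suc (S * S)

  1≤S : 1 ≤ S
  1≤S = 1≤size (encodeInstance I)

  S≤N : S ≤ N
  S≤N = m≤n⇒m≤1+n (m≤m*n S S {{>-nonZero 1≤S}})

  m≤S : m ≤ S
  m≤S = begin
    m                        ≡⟨ length-toList s ⟨
    length (toList s)        ≤⟨ length≤size encodeBit (toList s) ⟩
    size (encodeString s)    ≤⟨ m≤n+m _ _ ⟩
    S                        ∎
    where open ≤-Reasoning

  W≤S : length W ≤ S
  W≤S = ≤-trans (length≤size encodeString W) (≤-trans (m≤m+n _ _) (n≤1+n _))

  U≤N : suc (length (universe s)) ≤ N
  U≤N = s≤s (≤-trans (m≤n*m _ 4) (≤-trans (length-universe s) (*-mono-≤ m≤S m≤S)))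

  2+S²≤3S² : 2 + S * S ≤ 3 * (S * S)
  2+S²≤3S² = ≤-trans (+-monoˡ-≤ (S * S) (*-monoʳ-≤ 2 (*-mono-≤ 1≤S 1≤S)))
                     (≤-reflexive (+-comm (2 * (S * S)) (S * S)))

  open Budgeted.Timing program N maxSize body-size linear

  timed-run : ∃[ t ] (program ⟦ encodeInstance I ⟧⇓ encodeSolution (algorithm I) [ t ] ×
                      t ≤ maxSize * (3 * suc maxSize) ^ 10 * size (encodeInstance I) ^ (2 * 10))
  timed-run = cost-polynomial 10 (size (encodeInstance I)) 2+S²≤3S² (≤ᵇ⇒≤ _ _ _) refl
                (Correctness.main-run N W s (≤-trans m≤S S≤N) (≤-trans W≤S S≤N) U≤N)

polynomialTime : PolynomialTime encodeInstance encodeSolution algorithm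
polynomialTime =
  program , maxSize * (3 * suc maxSize) ^ 10 , 2 * 10 , Running.timed-run

mainTheorem4 : Σ[ A ∈ ((I : Instance) → RepresentationSubset I) ]
    (PolynomialTime encodeInstance encodeSolution A ×
    ((I : Instance) → 4 ≤ Instance.m I →
    (opt : ℕ) → IsMinimumCardinality I opt →
    ∣ A I ∣ ≤ 2 * opt ·ln (+ Instance.m I / 2)))
mainTheorem4 = algorithm , polynomialTime , approximation
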